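{- Let $(W,S)$ be a Coxeter system, let $I,J\subset S$ be finitary subsets, and let $p,q$ be $(I,J)$-cosets. The following conditions are equivalent. (1) $\overline{p}\leq \overline{q}$ in the Bruhat order on $W$. (2) $\underline{p}\leq \underline{q}$ in the Bruhat order on $W$ (i.e. $p\leq q$). (3) There exist a reduced expression $I_\bullet$ expressing $q$ and a path $p_\bullet$ subordinate to $I_\bullet$ such that $p=\mathrm{term}(p_\bullet)$. (4) For any (not necessarily reduced) expression $I_\bullet$ expressing $q$, there exists a path $p_\bullet$ subordinate to $I_\bullet$ such that $p=\mathrm{term}(p_\bullet)$.
   Context: $(W,S)$ is a Coxeter system with length function $\ell$. For $I\subset S$, $W_I$ is the subgroup generated by $I$; $I$ is finitary if $W_I$ is finite, and then $w_I$ is its longest element. The $*$-product on $W$ is the associative monoid product determined by $s*w=sw$ if $sw>w$ and $s*w=w$ if $sw<w$ ($s\in S$, $w\in W$), with unit the identity. An $(I,J)$-coset is an element $p\in W_I\backslash W/W_J$ (regarded as a triple $(p,I,J)$). $\overline{p}$ and $\underline{p}$ denote the maximal and minimal elements of the set $p$ in the Bruhat order. For $(I,J)$-cosets, $p\le q$ means $\underline p\le\underline q$. A (singlestep) expression, called an $(I,J)$-expression when $I_0=I$ and $I_d=J$, is a sequence $I_\bullet=[I_0,I_1,\dots,I_d]$ of finitary subsets of $S$ such that each $I_k$ is obtained from $I_{k-1}$ by adding or removing one element of $S$. It expresses the unique $(I_0,I_d)$-coset $q$ with $\overline{q}=w_{I_0}*w_{I_1}*\cdots*w_{I_d}$. Reduced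 expressions: recording the local maxima and minima of $I_\bullet$ gives a multistep expression $I_0=L_0\subset K_1\supset L_1\subset K_2\supset\cdots\subset K_m\supset L_m=I_d$ (with $L_0=K_1$ if $I_\bullet$ starts by decreasing and $K_m=L_m$ if it ends by increasing). $I_\bullet$, expressing $q$, is reduced if $\overline{q}=(w_{K_1}w_{L_1}^{ -1})(w_{K_2}w_{L_2}^{ -1})\cdots(w_{K_{m-1}}w_{L_{m-1}}^{ -1})\,w_{K_m}$ and the length of $\overline q$ is the sum of the lengths of these factors. A path subordinate to $I_\bullet=[I_0,\dots,I_d]$ is a sequence $p_\bullet=[p_0,\dots,p_d]$ where $p_k$ is an $(I_0,I_k)$-coset, $p_0$ is the $(I_0,I_0)$-coset containing the identity, and for each $k$: if $I_k\subset I_{k+1}$ then $p_{k+1}$ is the unique $(I_0,I_{k+1})$-coset containing $p_k$; if $I_k\supset I_{k+1}$ then $p_{k+1}$ is one of the $(I_0,I_{k+1})$-cosets contained in $p_k$. Its terminus is $\mathrm{term}(p_\bullet)=p_d$. -}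

module Defs where

open import Level using (Level; 0ℓ; _⊔_) renaming (suc to lsuc)
open import Algebra.Bundles using (Group)
open import Axiom.ExcludedMiddle using (ExcludedMiddle)
open import Data.Bool.Base using (if_then_else_)
open import Data.List.Base
  using (List; []; _∷_; _++_; _∷ʳ_; length; foldr; map; concat; replicate; cartesianProductWith)
open import Data.List.Extrema.Nat
  using (argmin; argmax; argmin-all; argmax-all; f[argmin]≤f[xs]; f[xs]≤f[argmax])
import Data.List.Membership.Setoid as Membership
open import Data.List.Membership.Setoid.Properties
  using (∈-cartesianProductWith⁺; ∈-cartesianProductWith⁻; ∈-resp-≈)
open import Data.List.Relation.Unary.All using (All; lookupₛ; tabulateₛ)
open import Data.Nat.Base using (ℕ; _≤_; _<_)
open import Data.Nat.Induction using (<-wellFounded)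
open import Data.Nat.ListAction using (sum)
import Data.Nat.Properties as ℕ
open import Data.Product.Base using (∃; ∃₂; _×_; _,_; proj₁; proj₂; map₂)
open import Data.Sum.Base using (_⊎_; inj₁; inj₂)
open import Function.Bundles using (_⇔_; mk⇔; Equivalence)
open import Induction.WellFounded using (Acc; acc)
open import Relation.Binary.Construct.Closure.Equivalence using (EqClosure)
open import Relation.Binary.Core using (Rel)
open import Relation.Binary.PropositionalEquality using (_≡_)
open import Relation.Nullary using (¬_; yes; no; contradiction)
open import Relation.Nullary.Decidable using (⌊_⌋)
open import Relation.Unary using (Pred; _∈_; _∉_; _⊆_; _≐_; _∪_; ｛_｝)

-- The entry 0 encodes m(s,t) = ∞.
record CoxeterMatrix {s} (S : Set s) : Set s where
  field
    m     : S → S → ℕ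
    m-sym : ∀ s t → m s t ≡ m t s
    m≡1   : ∀ s t → m s t ≡ 1 ⇔ s ≡ t

module _ {s} {S : Set s} (M : CoxeterMatrix S) where
  open CoxeterMatrix M

  data Relator : Rel (List S) s where
    relator : ∀ u s t v →
              Relator (u ++ concat (replicate (m s t) (s ∷ t ∷ [])) ++ v) (u ++ v)

  -- The monoid congruence generated by (st)^m(s,t) = 1. As m(s,s) = 1 it
  -- contains ss = 1, so the quotient of List S is the group presented by these
  -- relations. If m(s,t) = ∞ the relator is trivial, being a zeroth power.
  CoxeterCongruence : Rel (List S) s
  CoxeterCongruence = EqClosure Relator

record CoxeterSystem c e s : Set (lsuc (c ⊔ e ⊔ s)) where
  field
    group  : Group c e
  open Group group public hiding (refl; sym; trans; setoid)
  open Group group public using (setoid)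
    renaming (refl to ≈-refl; sym to ≈-sym; trans to ≈-trans)
  field
    S      : Set s
    matrix : CoxeterMatrix S
    gen    : S → Carrier

  ⟦_⟧ : List S → Carrier
  ⟦_⟧ = foldr (λ s w → gen s ∙ w) ε

  field
    generates : ∀ w → ∃ λ u → ⟦ u ⟧ ≈ w
    presented : ∀ u v → ⟦ u ⟧ ≈ ⟦ v ⟧ ⇔ CoxeterCongruence matrix u v

-- Excluded middle is what makes the length, the *-product and the extremal
-- elements below into functions.
module Coxeter (em : ∀ {a} → ExcludedMiddle a)
               {c e s : Level} (C : CoxeterSystem c e s) where
  open CoxeterSystem C
  open Membership setoid using () renaming (_∈_ to _∈ₗ_)

  private
    L : Level
    L = c ⊔ e ⊔ s

  Shortest : Carrier → Pred (List S) (e ⊔ s)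
  Shortest w u = ⟦ u ⟧ ≈ w × (∀ v → ⟦ v ⟧ ≈ w → length u ≤ length v)

  abstract
    shortest-exists : ∀ w → ∃ (Shortest w)
    shortest-exists w = let u , u≈w = generates w in go u u≈w (<-wellFounded (length u))
      where
      go : ∀ u → ⟦ u ⟧ ≈ w → Acc _<_ (length u) → ∃ (Shortest w)
      go u u≈w (acc rec) with em {P = ∃ λ v → ⟦ v ⟧ ≈ w × length v < length u}
      ... | yes (v , v≈w , v<u) = go v v≈w (rec v<u)
      ... | no ∄v = u , u≈w , λ v v≈w → ℕ.≮⇒≥ λ v<u → ∄v (v , v≈w , v<u)

  reducedWord : Carrier → List S
  reducedWord w = proj₁ (shortest-exists w)

  ℓ : Carrier → ℕ
  ℓ w = length (reducedWord w)

  ℓ-mono : ∀ {x y} → x ≈ y → ℓ x ≤ ℓ y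
  ℓ-mono {x} {y} x≈y =
    proj₂ (proj₂ (shortest-exists x)) (reducedWord y)
      (≈-trans (proj₁ (proj₂ (shortest-exists y))) (≈-sym x≈y))

  Reflection : Pred Carrier L
  Reflection t = ∃₂ λ w s → t ≈ w ∙ gen s ∙ w ⁻¹

  infix 4 _≤ᴮ_ _<ᴮ_

  data _≤ᴮ_ (x : Carrier) : Pred Carrier L where
    ≤ᴮ-refl : ∀ {y} → x ≈ y → x ≤ᴮ y
    ≤ᴮ-step : ∀ {y z t} → x ≤ᴮ y → t ∈ Reflection → z ≈ y ∙ t → ℓ y < ℓ z → x ≤ᴮ z

  _<ᴮ_ : Rel Carrier L
  x <ᴮ y = x ≤ᴮ y × ¬ x ≈ y

  ≤ᴮ⇒ℓ≤ : ∀ {x y} → x ≤ᴮ y → ℓ x ≤ ℓ y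
  ≤ᴮ⇒ℓ≤ (≤ᴮ-refl x≈y)        = ℓ-mono x≈y
  ≤ᴮ⇒ℓ≤ (≤ᴮ-step x≤y _ _ lt) = ℕ.≤-trans (≤ᴮ⇒ℓ≤ x≤y) (ℕ.<⇒≤ lt)

  ≤ᴮ⇒≈⊎ℓ< : ∀ {x y} → x ≤ᴮ y → x ≈ y ⊎ ℓ x < ℓ y
  ≤ᴮ⇒≈⊎ℓ< (≤ᴮ-refl x≈y)        = inj₁ x≈y
  ≤ᴮ⇒≈⊎ℓ< (≤ᴮ-step x≤y _ _ lt) = inj₂ (ℕ.≤-<-trans (≤ᴮ⇒ℓ≤ x≤y) lt)

  act : S → Carrier → Carrier
  act s w = if ⌊ em {P = w <ᴮ gen s ∙ w} ⌋ then gen s ∙ w else w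

  infixl 7 _⋆_

  -- Here act s w is s * w. Writing x = s₁ ⋯ sₖ with k = ℓ(x), the rule for s * w
  -- gives x = s₁ * ⋯ * sₖ, hence x * y = s₁ * (⋯ * (sₖ * y)) by associativity.
  _⋆_ : Carrier → Carrier → Carrier
  x ⋆ y = foldr act y (reducedWord x)

  -- The subgroup W_I. Excluded middle makes predicates at level 0 represent
  -- all subsets of S.
  data ⟨_⟩ (I : Pred S 0ℓ) : Pred Carrier L where
    ⟨gen⟩ : ∀ {s} → s ∈ I → gen s ∈ ⟨ I ⟩
    ⟨ε⟩   : ε ∈ ⟨ I ⟩
    ⟨∙⟩   : ∀ {x y} → x ∈ ⟨ I ⟩ → y ∈ ⟨ I ⟩ → x ∙ y ∈ ⟨ I ⟩
    ⟨⁻¹⟩  : ∀ {x} → x ∈ ⟨ I ⟩ → x ⁻¹ ∈ ⟨ I ⟩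
    ⟨≈⟩   : ∀ {x y} → x ≈ y → x ∈ ⟨ I ⟩ → y ∈ ⟨ I ⟩

  Finite : Pred Carrier L → Set L
  Finite P = ∃ λ xs → ∀ x → x ∈ P ⇔ x ∈ₗ xs

  record Finitary : Set (lsuc 0ℓ ⊔ L) where
    field
      set    : Pred S 0ℓ
      finite : Finite ⟨ set ⟩
  open Finitary public

  module _ {P : Pred Carrier L} (fin : Finite P) {x₀} (x₀∈P : x₀ ∈ P) where
    private
      xs   = proj₁ fin
      to   = λ {x} → Equivalence.to (proj₂ fin x)
      from = λ {x} → Equivalence.from (proj₂ fin x)

    abstract
      ℓ-max-exists : ∃ λ w → w ∈ P × (∀ x → x ∈ P → ℓ x ≤ ℓ w)
      ℓ-max-exists = argmax ℓ x₀ xs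
        , argmax-all ℓ {P = P} x₀∈P (tabulateₛ setoid from)
        , λ x x∈P → lookupₛ setoid (λ x≈y → ℕ.≤-trans (ℓ-mono (≈-sym x≈y)))
                      (f[xs]≤f[argmax] x₀ xs) (to x∈P)

      ℓ-min-exists : ∃ λ w → w ∈ P × (∀ x → x ∈ P → ℓ w ≤ ℓ x)
      ℓ-min-exists = argmin ℓ x₀ xs
        , argmin-all ℓ {P = P} x₀∈P (tabulateₛ setoid from)
        , λ x x∈P → lookupₛ setoid (λ x≈y ≤x → ℕ.≤-trans ≤x (ℓ-mono x≈y))
                      (f[argmin]≤f[xs] x₀ xs) (to x∈P)

  longest : Finitary → Carrier
  longest I = proj₁ (ℓ-max-exists (finite I) ⟨ε⟩)

  -- A double coset is given by a representative; two representatives give the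
  -- same coset when they have the same elements.
  record Coset (I J : Finitary) : Set c where
    field
      rep : Carrier
  open Coset public

  elements : ∀ {I J} → Coset I J → Pred Carrier L
  elements {I} {J} p x =
    ∃₂ λ a b → a ∈ ⟨ set I ⟩ × b ∈ ⟨ set J ⟩ × x ≈ a ∙ rep p ∙ b

  abstract
    elements-finite : ∀ {I J} (p : Coset I J) → Finite (elements p)
    elements-finite {I} {J} p = cartesianProductWith f as bs , λ x → mk⇔ to from
      where
      as bs : List Carrier
      as = proj₁ (finite I)
      bs = proj₁ (finite J)

      f : Carrier → Carrier → Carrier
      f a b = a ∙ rep p ∙ b

      to : ∀ {x} → x ∈ elements p → x ∈ₗ cartesianProductWith f as bs
      to (a , b , a∈ , b∈ , x≈) = ∈-resp-≈ setoid (≈-sym x≈)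
        (∈-cartesianProductWith⁺ setoid setoid setoid
          {f = f} (λ a≈a′ b≈b′ → ∙-cong (∙-congʳ a≈a′) b≈b′)
          (Equivalence.to (proj₂ (finite I) a) a∈)
          (Equivalence.to (proj₂ (finite J) b) b∈))

      from : ∀ {x} → x ∈ₗ cartesianProductWith f as bs → x ∈ elements p
      from x∈ with a , b , a∈ , b∈ , x≈ ← ∈-cartesianProductWith⁻ setoid setoid setoid f as bs x∈
        = a , b , Equivalence.from (proj₂ (finite I) a) a∈
                , Equivalence.from (proj₂ (finite J) b) b∈ , x≈

  rep∈elements : ∀ {I J} (p : Coset I J) → rep p ∈ elements p
  rep∈elements p =
    ε , ε , ⟨ε⟩ , ⟨ε⟩ , ≈-sym (≈-trans (identityʳ _) (identityˡ _))

  Maximal Minimal : Pred Carrier L → Pred Carrier L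
  Maximal P w = w ∈ P × (∀ x → x ∈ P → w ≤ᴮ x → w ≈ x)
  Minimal P w = w ∈ P × (∀ x → x ∈ P → x ≤ᴮ w → w ≈ x)

  abstract
    ℓ-max⇒maximal : ∀ {P w} → w ∈ P × (∀ x → x ∈ P → ℓ x ≤ ℓ w) → Maximal P w
    ℓ-max⇒maximal {P} {w} (w∈P , ≤w) = w∈P , λ x x∈P w≤x → case (≤w x x∈P) (≤ᴮ⇒≈⊎ℓ< w≤x)
      where
      case : ∀ {x} → ℓ x ≤ ℓ w → w ≈ x ⊎ ℓ w < ℓ x → w ≈ x
      case _   (inj₁ w≈x) = w≈x
      case x≤w (inj₂ w<x) = contradiction w<x (ℕ.≤⇒≯ x≤w)

    ℓ-min⇒minimal : ∀ {P w} → w ∈ P × (∀ x → x ∈ P → ℓ w ≤ ℓ x) → Minimal P w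
    ℓ-min⇒minimal {P} {w} (w∈P , w≤) = w∈P , λ x x∈P x≤w → case (w≤ x x∈P) (≤ᴮ⇒≈⊎ℓ< x≤w)
      where
      case : ∀ {x} → ℓ w ≤ ℓ x → x ≈ w ⊎ ℓ x < ℓ w → w ≈ x
      case _   (inj₁ x≈w) = ≈-sym x≈w
      case w≤x (inj₂ x<w) = contradiction x<w (ℕ.≤⇒≯ w≤x)

    maximal-exists : ∀ {I J} (p : Coset I J) → ∃ (Maximal (elements p))
    maximal-exists p =
      map₂ ℓ-max⇒maximal (ℓ-max-exists (elements-finite p) (rep∈elements p))

    minimal-exists : ∀ {I J} (p : Coset I J) → ∃ (Minimal (elements p))
    minimal-exists p =
      map₂ ℓ-min⇒minimal (ℓ-min-exists (elements-finite p) (rep∈elements p))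

  max min : ∀ {I J} → Coset I J → Carrier
  max p = proj₁ (maximal-exists p)
  min p = proj₁ (minimal-exists p)

  infix 4 _⋖_

  _⋖_ : Finitary → Finitary → Set s
  K ⋖ L = ∃ λ s → s ∉ set K × set L ≐ set K ∪ ｛ s ｝

  infixl 5 _▷⁺_ _▷⁻_

  -- Expression I J is the type of (I,J)-expressions. The expression [ I ] of
  -- length 0 is an (I,J)-expression whenever I and J are equal as sets.
  data Expression (I : Finitary) : Finitary → Set (lsuc 0ℓ ⊔ L) where
    [_]  : ∀ {J} → set I ≐ set J → Expression I J
    _▷⁺_ : ∀ {K J} → Expression I K → K ⋖ J → Expression I J
    _▷⁻_ : ∀ {K J} → Expression I K → J ⋖ K → Expression I J

  ⋆-product : ∀ {I J} → Expression I J → Carrier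
  ⋆-product {I}     [ _ ]    = longest I
  ⋆-product {J = J} (E ▷⁺ _) = ⋆-product E ⋆ longest J
  ⋆-product {J = J} (E ▷⁻ _) = ⋆-product E ⋆ longest J

  Expresses : ∀ {I J} → Expression I J → Coset I J → Set e
  Expresses E q = max q ≈ ⋆-product E

  data Direction : Set where
    ascending descending : Direction

  -- The multistep expression of E read from the left: the pairs (Kᵢ , Lᵢ) with
  -- i < m, the last local maximum Kₘ, and the direction of the last run. An
  -- initial (possibly empty) run counts as ascending, so that K₁ = I when E
  -- starts by decreasing.
  record Turns : Set (lsuc 0ℓ ⊔ L) where
    constructor turns
    field
      pairs     : List (Finitary × Finitary)
      peak      : Finitary
      direction : Direction

  multistep : ∀ {I J} → Expression I J → Turns
  multistep {I} [ _ ] = turns [] I ascending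
  multistep {J = J} (_▷⁺_ {K = K} E _) with multistep E
  ... | turns ps _    ascending  = turns ps J ascending
  ... | turns ps peak descending = turns (ps ∷ʳ (peak , K)) J ascending
  multistep (E ▷⁻ _) with multistep E
  ... | turns ps peak _ = turns ps peak descending

  factors : ∀ {I J} → Expression I J → List Carrier
  factors E = map (λ (K , L) → longest K ∙ longest L ⁻¹) pairs ∷ʳ longest peak
    where open Turns (multistep E)

  Reduced : ∀ {I J} → Expression I J → Coset I J → Set e
  Reduced E q = max q ≈ foldr _∙_ ε (factors E)
              × ℓ (max q) ≡ sum (map ℓ (factors E))

  -- Path E p is the type of paths subordinate to E with terminus p.
  data Path {I : Finitary} : ∀ {J} → Expression I J → Coset I J → Set (lsuc 0ℓ ⊔ L) where
    start : ∀ {J} {I≐J : set I ≐ set J} {p : Coset I J} →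
            ε ∈ elements p → Path [ I≐J ] p
    up    : ∀ {K J} {E : Expression I K} {K⋖J : K ⋖ J} {p : Coset I K} {p′ : Coset I J} →
            Path E p → elements p ⊆ elements p′ → Path (E ▷⁺ K⋖J) p′
    down  : ∀ {K J} {E : Expression I K} {J⋖K : J ⋖ K} {p : Coset I K} {p′ : Coset I J} →
            Path E p → elements p′ ⊆ elements p → Path (E ▷⁻ J⋖K) p′

{-# OPTIONS --safe #-}
-- The *-product turns lower Bruhat intervals into products of sets: if D(w) = {y | y ≤ w} then
-- D(x * y) = D(x) D(y), and D(w_I) = W_I. Hence D(w_I₀ * ⋯ * w_I_d) = W_I₀ ⋯ W_I_d, which is the
-- union of the termini of the paths subordinate to [I₀, …, I_d]; so for any expression of q, p is
-- such a terminus if and only if p̄ ≤ q̄. The identity for x = s is the lifting property. It comes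
-- from the cocycle η(w, t) ∈ ℤ/2 counting how often t occurs among the reflections along a word for
-- w: η(w, t) = 1 if and only if ℓ(tw) < ℓ(w).
-- That S embeds in W, without which infinite finitary subsets would not be excluded, needs a linear
-- representation; cos(π/m) is replaced by the adjacency operator of a path with m - 1 vertices.
module Submission where

open import Defs
open import Level using (Level; 0ℓ; _⊔_) renaming (suc to lsuc)
open import Algebra.Bundles using (Group)
open import Axiom.ExcludedMiddle using (ExcludedMiddle)
open import Data.Bool.Base using (Bool; true; false; not; _xor_)
open import Data.Bool.Properties using (xor-assoc; xor-same; xor-identityʳ)
open import Data.Fin.Base using (Fin)
import Data.Fin.Properties as Fin
open import Data.Integer.Base as ℤ using (ℤ; 0ℤ; 1ℤ)
import Data.Integer.Properties as ℤ
import Data.Integer.Tactic.RingSolver as ℤ-Solver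
open import Data.List.Base
  using (List; []; _∷_; _++_; _∷ʳ_; length; foldr; concat; replicate; reverse; map; filter)
import Data.List.Membership.Propositional as Propositional
import Data.List.Membership.Setoid as Membership
open import Data.List.Membership.Setoid.Properties
  using (∈-filter⁺; ∈-filter⁻; ∈-map⁺; ∈-++⁺ˡ; ∈-++⁺ʳ; ∈-resp-≈)
open import Data.List.Properties using (foldr-++; length-++; length-reverse; map-++; unfold-reverse; ++-identityʳ)
open import Data.List.Relation.Unary.Any using (here; there)
open import Data.Nat.Base using (ℕ; zero; suc; pred; _+_; _*_; _∸_; _≤_; _<_; _%_; _/_; z≤n; s≤s)
import Data.Nat.DivMod as ℕ
open import Data.Nat.Induction using (<-wellFounded)
open import Data.Nat.ListAction using (sum)
open import Data.Nat.ListAction.Properties using (sum-++)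
import Data.Nat.Properties as ℕ
import Data.Nat.Tactic.RingSolver as ℕ-Solver
open import Data.Product.Base using (∃; ∃₂; Σ-syntax; _×_; _,_; proj₁; proj₂)
open import Data.Sum.Base as Sum using (_⊎_; inj₁; inj₂)
open import Data.Unit.Base using (⊤; tt)
open import Data.Vec.Base using (Vec; lookup)
open import Function.Bundles using (_⇔_; mk⇔; Equivalence)
open import Induction.WellFounded using (Acc; acc)
open import Relation.Binary.Bundles using (Setoid)
import Relation.Binary.Construct.Closure.Equivalence as EqClosure
open import Relation.Binary.Definitions using (DecidableEquality)
open import Relation.Binary.PropositionalEquality as ≡
  using (_≡_; _≗_; refl; sym; trans; cong; cong₂; subst; module ≡-Reasoning)
import Relation.Binary.Reflection
open import Relation.Nullary using (Dec; ¬_; does; yes; no; contradiction)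
open import Relation.Nullary.Decidable using (True; toWitness; fromWitness; does-⇔)
open import Relation.Unary using (Pred; _∈_; _∉_; _⊆_; _≐_; _∪_; ｛_｝)

-- Beyond the comparison with products, condition (3) needs q to have a reduced expression at all.
-- It is built from its right end by induction on the length of w, the maximal element of q. The
-- last peak is the set R of all right descents of w. Taking all of them keeps the induction going:
-- if the element left for the induction were no shorter than w, then the shortest element of w W_R
-- would be the identity and w = w_I.
--
-- Steps of an expression change one element of S at a time, so it is R that has to be finite, not
-- only W_R; this is the point at which the injectivity of S → W enters.
--
-- The operator standing in for 2 cos(π/m) lives on functions on all of ℕ, which is cut into paths
-- of m - 1 vertices, so that all m act on one space. The order of st is then found without
-- eigenvalues: applying the two reflections in turn iterates a discrete wave equation on a path,
-- and every solution with zero boundary values at distance m has period 2 m.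

-- A solver for equations in groups

module GroupSolver {c e : Level} (G : Group c e) where
  open Group G renaming (refl to ≈-refl; sym to ≈-sym; trans to ≈-trans)
  open import Algebra.Properties.Group G using (⁻¹-anti-homo-∙; ε⁻¹≈ε; ⁻¹-involutive)
  open import Relation.Binary.Reasoning.Setoid setoid

  infixl 7 _⊕_
  infix 8 ⊖_

  data Expr (n : ℕ) : Set where
    var : Fin n → Expr n
    _⊕_ : Expr n → Expr n → Expr n
    ⊖_  : Expr n → Expr n
    𝟙   : Expr n

  Word : ℕ → Set
  Word n = List (Bool × Fin n)

  letter : ∀ {n} → Bool → Fin n → Vec Carrier n → Carrier
  letter true  i ρ = lookup ρ i
  letter false i ρ = lookup ρ i ⁻¹

  ⟦_⟧ᵉ : ∀ {n} → Expr n → Vec Carrier n → Carrier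
  ⟦ var i ⟧ᵉ ρ = lookup ρ i
  ⟦ a ⊕ b ⟧ᵉ ρ = ⟦ a ⟧ᵉ ρ ∙ ⟦ b ⟧ᵉ ρ
  ⟦ ⊖ a   ⟧ᵉ ρ = ⟦ a ⟧ᵉ ρ ⁻¹
  ⟦ 𝟙     ⟧ᵉ ρ = ε

  ⟦_⟧ʷ : ∀ {n} → Word n → Vec Carrier n → Carrier
  ⟦ [] ⟧ʷ          ρ = ε
  ⟦ (b , i) ∷ w ⟧ʷ ρ = letter b i ρ ∙ ⟦ w ⟧ʷ ρ

  push : ∀ {n} → Bool → Fin n → Word n → Word n
  push b i [] = (b , i) ∷ []
  push b i ((b′ , j) ∷ w) with i Fin.≟ j
  push true  i ((true  , j) ∷ w) | yes _ = (true , i) ∷ (true , j) ∷ w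
  push true  i ((false , j) ∷ w) | yes _ = w
  push false i ((true  , j) ∷ w) | yes _ = w
  push false i ((false , j) ∷ w) | yes _ = (false , i) ∷ (false , j) ∷ w
  push b     i ((b′    , j) ∷ w) | no _  = (b , i) ∷ (b′ , j) ∷ w

  -- nf b e w is the free reduction of e or e ⁻¹, as b says, followed by w.
  nf : ∀ {n} → Bool → Expr n → Word n → Word n
  nf b     (var i) w = push b i w
  nf true  (a ⊕ c) w = nf true a (nf true c w)
  nf false (a ⊕ c) w = nf false c (nf false a w)
  nf b     (⊖ a)   w = nf (not b) a w
  nf b     𝟙       w = w

  signed : ∀ {n} → Bool → Expr n → Vec Carrier n → Carrier
  signed true  a ρ = ⟦ a ⟧ᵉ ρ
  signed false a ρ = ⟦ a ⟧ᵉ ρ ⁻¹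

  push-correct : ∀ {n} b (i : Fin n) w ρ → ⟦ push b i w ⟧ʷ ρ ≈ letter b i ρ ∙ ⟦ w ⟧ʷ ρ
  push-correct b i [] ρ = ≈-refl
  push-correct b i ((b′ , j) ∷ w) ρ with i Fin.≟ j
  push-correct true  i ((true  , j) ∷ w) ρ | yes _    = ≈-refl
  push-correct true  i ((false , j) ∷ w) ρ | yes refl =
    ≈-sym (≈-trans (≈-sym (assoc _ _ _)) (≈-trans (∙-congʳ (inverseʳ _)) (identityˡ _)))
  push-correct false i ((true  , j) ∷ w) ρ | yes refl =
    ≈-sym (≈-trans (≈-sym (assoc _ _ _)) (≈-trans (∙-congʳ (inverseˡ _)) (identityˡ _)))
  push-correct false i ((false , j) ∷ w) ρ | yes _    = ≈-refl
  push-correct b     i ((b′    , j) ∷ w) ρ | no _     = ≈-refl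

  nf-correct : ∀ {n} b (a : Expr n) w ρ → ⟦ nf b a w ⟧ʷ ρ ≈ signed b a ρ ∙ ⟦ w ⟧ʷ ρ
  nf-correct true  (var i) w ρ = push-correct true i w ρ
  nf-correct false (var i) w ρ = push-correct false i w ρ
  nf-correct true  (a ⊕ c) w ρ = begin
    ⟦ nf true a (nf true c w) ⟧ʷ ρ     ≈⟨ nf-correct true a _ ρ ⟩
    ⟦ a ⟧ᵉ ρ ∙ ⟦ nf true c w ⟧ʷ ρ      ≈⟨ ∙-congˡ (nf-correct true c w ρ) ⟩
    ⟦ a ⟧ᵉ ρ ∙ (⟦ c ⟧ᵉ ρ ∙ ⟦ w ⟧ʷ ρ)   ≈⟨ assoc _ _ _ ⟨
    ⟦ a ⟧ᵉ ρ ∙ ⟦ c ⟧ᵉ ρ ∙ ⟦ w ⟧ʷ ρ     ∎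
  nf-correct false (a ⊕ c) w ρ = begin
    ⟦ nf false c (nf false a w) ⟧ʷ ρ             ≈⟨ nf-correct false c _ ρ ⟩
    ⟦ c ⟧ᵉ ρ ⁻¹ ∙ ⟦ nf false a w ⟧ʷ ρ            ≈⟨ ∙-congˡ (nf-correct false a w ρ) ⟩
    ⟦ c ⟧ᵉ ρ ⁻¹ ∙ (⟦ a ⟧ᵉ ρ ⁻¹ ∙ ⟦ w ⟧ʷ ρ)       ≈⟨ assoc _ _ _ ⟨
    ⟦ c ⟧ᵉ ρ ⁻¹ ∙ ⟦ a ⟧ᵉ ρ ⁻¹ ∙ ⟦ w ⟧ʷ ρ         ≈⟨ ∙-congʳ (⁻¹-anti-homo-∙ _ _) ⟨
    (⟦ a ⟧ᵉ ρ ∙ ⟦ c ⟧ᵉ ρ) ⁻¹ ∙ ⟦ w ⟧ʷ ρ          ∎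
  nf-correct true  (⊖ a) w ρ = nf-correct false a w ρ
  nf-correct false (⊖ a) w ρ =
    ≈-trans (nf-correct true a w ρ) (∙-congʳ (≈-sym (⁻¹-involutive _)))
  nf-correct true  𝟙 w ρ = ≈-sym (identityˡ _)
  nf-correct false 𝟙 w ρ = ≈-sym (≈-trans (∙-congʳ ε⁻¹≈ε) (identityˡ _))

  ⟦_⇓⟧ : ∀ {n} → Expr n → Vec Carrier n → Carrier
  ⟦ a ⇓⟧ = ⟦ nf true a [] ⟧ʷ

  open Relation.Binary.Reflection setoid var ⟦_⟧ᵉ ⟦_⇓⟧
    (λ a ρ → ≈-trans (nf-correct true a [] ρ) (identityʳ _)) public
    using (solve; _⊜_)

-- The discrete wave equation on paths

guard : ℕ → ℤ → ℤ
guard zero    x = 0ℤ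
guard (suc _) x = x

-- The adjacency operator of the graph on ℕ whose components are paths with m ∸ 1
-- vertices. The eigenvalues of such a path are 2 cos (jπ / m) with 0 < j < m.
neighbours : ℕ → (ℕ → ℤ) → ℕ → ℤ
neighbours (suc (suc n)) y p = guard (p % suc n) (y (pred p)) ℤ.+ guard (suc p % suc n) (y (suc p))
neighbours _             y p = 0ℤ

guard-cong : ∀ k {x y} → x ≡ y → guard k x ≡ guard k y
guard-cong k = cong (guard k)

guard-0 : ∀ k → guard k 0ℤ ≡ 0ℤ
guard-0 zero    = refl
guard-0 (suc k) = refl

guard-+ : ∀ k x y → guard k (x ℤ.+ y) ≡ guard k x ℤ.+ guard k y
guard-+ zero    x y = refl
guard-+ (suc k) x y = refl

neighbours-cong : ∀ m {y z} → y ≗ z → neighbours m y ≗ neighbours m z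
neighbours-cong zero          y≗z p = refl
neighbours-cong (suc zero)    y≗z p = refl
neighbours-cong (suc (suc n)) y≗z p =
  cong₂ ℤ._+_ (guard-cong (p % suc n) (y≗z _)) (guard-cong (suc p % suc n) (y≗z _))

neighbours-+ : ∀ m y z p →
  neighbours m (λ i → y i ℤ.+ z i) p ≡ neighbours m y p ℤ.+ neighbours m z p
neighbours-+ zero          y z p = refl
neighbours-+ (suc zero)    y z p = refl
neighbours-+ (suc (suc n)) y z p =
  trans (cong₂ ℤ._+_ (guard-+ (p % suc n) _ _) (guard-+ (suc p % suc n) _ _))
        (shuffle (guard (p % suc n) (y (pred p))) _ _ _)
  where
  shuffle : ∀ a b c d → (a ℤ.+ b) ℤ.+ (c ℤ.+ d) ≡ (a ℤ.+ c) ℤ.+ (b ℤ.+ d)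
  shuffle = ℤ-Solver.solve-∀

neighbours-0 : ∀ m p → neighbours m (λ _ → 0ℤ) p ≡ 0ℤ
neighbours-0 zero          p = refl
neighbours-0 (suc zero)    p = refl
neighbours-0 (suc (suc n)) p = cong₂ ℤ._+_ (guard-0 (p % suc n)) (guard-0 (suc p % suc n))

[i+kn]%n : ∀ {i n} k → i < suc n → (i + k * suc n) % suc n ≡ i
[i+kn]%n {i} {n} k i<n = trans (ℕ.[m+kn]%n≡m%n i k (suc n)) (ℕ.m<n⇒m%n≡m i<n)

sum< : ℕ → (ℕ → ℤ) → ℤ
sum< zero    g = 0ℤ
sum< (suc k) g = sum< k g ℤ.+ g k

sum<-cong : ∀ k {g h} → g ≗ h → sum< k g ≡ sum< k h
sum<-cong zero    g≗h = refl
sum<-cong (suc k) g≗h = cong₂ ℤ._+_ (sum<-cong k g≗h) (g≗h k)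

sum<-minus : ∀ k g h → sum< k (λ r → g r ℤ.- h r) ≡ sum< k g ℤ.- sum< k h
sum<-minus zero    g h = refl
sum<-minus (suc k) g h = trans (cong (ℤ._+ (g k ℤ.- h k)) (sum<-minus k g h)) (shuffle (sum< k g) _ _ _)
  where
  shuffle : ∀ a b c d → (a ℤ.- b) ℤ.+ (c ℤ.- d) ≡ (a ℤ.+ c) ℤ.- (b ℤ.+ d)
  shuffle = ℤ-Solver.solve-∀

sum<-suc : ∀ k g → sum< (suc k) g ≡ g 0 ℤ.+ sum< k (λ r → g (suc r))
sum<-suc zero    g = ℤ.+-comm 0ℤ (g 0)
sum<-suc (suc k) g = trans (cong (ℤ._+ g (suc k)) (sum<-suc k g)) (ℤ.+-assoc (g 0) _ _)

module Periodic (A : ℕ → ℤ) (m : ℕ) (period : ∀ k → A (k + (m + m)) ≡ A k) where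
  double : ℕ → ℕ → ℤ
  double h r = A (h + (r + r))

  -- Shifting by two drops the term `A h` and gains `A (h + (m + m))`, which is equal to it.
  sum<-shift² : ∀ h → sum< m (double (suc (suc h))) ≡ sum< m (double h)
  sum<-shift² h = ∙-cancelˡ (A h) _ _ (begin
    A h ℤ.+ sum< m (double (suc (suc h)))              ≡⟨ cong₂ ℤ._+_ (cong A (ℕ.+-identityʳ h))
                                                            (sum<-cong m λ r → cong A (shift h r)) ⟨
    double h 0 ℤ.+ sum< m (λ r → double h (suc r))     ≡⟨ sum<-suc m (double h) ⟨
    sum< m (double h) ℤ.+ A (h + (m + m))              ≡⟨ cong (λ z → sum< m (double h) ℤ.+ z) (period h) ⟩
    sum< m (double h) ℤ.+ A h                          ≡⟨ ℤ.+-comm _ (A h) ⟩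
    A h ℤ.+ sum< m (double h)                          ∎)
    where
    open ≡-Reasoning
    open import Algebra.Properties.AbelianGroup ℤ.+-0-abelianGroup using (∙-cancelˡ)
    shift : ∀ h r → h + (suc r + suc r) ≡ suc (suc h) + (r + r)
    shift = ℕ-Solver.solve-∀

  sum<-shift : ∀ h d → sum< m (double (h + (d + d))) ≡ sum< m (double h)
  sum<-shift h zero    = cong (λ k → sum< m (double k)) (ℕ.+-identityʳ h)
  sum<-shift h (suc d) = trans (cong (λ k → sum< m (double k)) (shift h d))
    (trans (sum<-shift² (h + (d + d))) (sum<-shift h d))
    where
    shift : ∀ h d → h + (suc d + suc d) ≡ suc (suc (h + (d + d)))
    shift = ℕ-Solver.solve-∀

-- Within a component, x k solves the wave equation x (k + 2) + x k = neighbours (x (k + 1))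
-- with zero boundary values. D'Alembert's solution is x k j = A (k + m - j) - A (k + m + j)
-- for 0 < j < m, where A has period 2 m; below m = n + 2, j = i + 1 and m - j = l + 1.
module Component (n q : ℕ) where
  m : ℕ
  m = suc (suc n)

  at : ℕ → ℕ
  at i = i + q * suc n

  travelling : (ℕ → ℤ) → ℕ → ℕ → ℕ → ℤ
  travelling A k i l = A (k + suc l) ℤ.- A (k + suc (suc (suc (n + i))))

  Wave NegWave : (ℕ → ℤ) → ℕ → (ℕ → ℤ) → Set
  Wave    A k y = ∀ i l → i + l ≡ n → y (at i) ≡ travelling A k i l
  NegWave A k y = ∀ i l → i + l ≡ n → y (at i) ≡ ℤ.- travelling A k i l

  module _ (A : ℕ → ℤ) (period : ∀ k → A (k + (m + m)) ≡ A k) where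
    private
      i≤ : ∀ {i l} → i + l ≡ n → i < suc n
      i≤ {i} {l} eq = s≤s (subst (i ≤_) eq (ℕ.m≤m+n i l))

      left : ∀ k y i l → i + l ≡ n → Wave A k y →
             guard (at i % suc n) (y (pred (at i))) ≡ A (k + suc (suc l)) ℤ.- A (k + suc (suc (n + i)))
      left k y zero .n refl wave =
        trans (cong (λ z → guard z (y (pred (at 0)))) ([i+kn]%n q (i≤ {0} refl)))
          (sym (trans (cong (λ z → A (k + suc (suc n)) ℤ.- A (k + suc (suc z))) (ℕ.+-identityʳ n))
                      (ℤ.+-inverseʳ (A (k + suc (suc n))))))
      left k y (suc i) l eq wave =
        trans (cong (λ z → guard z (y (at i))) ([i+kn]%n q (i≤ eq)))
          (trans (wave i (suc l) (trans (ℕ.+-suc i l) eq))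
                 (cong (λ z → A (k + suc (suc l)) ℤ.- A (k + suc (suc z))) (sym (ℕ.+-suc n i))))

      right : ∀ k y i l → i + l ≡ n → Wave A k y →
              guard (suc (at i) % suc n) (y (suc (at i))) ≡
              A (k + l) ℤ.- A (k + suc (suc (suc (suc (n + i)))))
      right k y i zero eq wave with refl ← trans (sym (ℕ.+-identityʳ i)) eq =
        trans (cong (λ z → guard z (y (suc (at n)))) ([i+kn]%n {0} {n} (suc q) (s≤s z≤n)))
          (sym (trans (cong₂ (λ a b → A a ℤ.- A b) (ℕ.+-identityʳ k) (wrap k n))
               (trans (cong (λ z → A k ℤ.- z) (period k)) (ℤ.+-inverseʳ (A k)))))
        where
        wrap : ∀ k n → k + suc (suc (suc (suc (n + n)))) ≡ k + (suc (suc n) + suc (suc n))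
        wrap = ℕ-Solver.solve-∀
      right k y i (suc l) eq wave =
        trans (cong (λ z → guard z (y (at (suc i)))) ([i+kn]%n q (i≤ {suc i} {l} eq′)))
          (trans (wave (suc i) l eq′)
                 (cong (λ z → A (k + suc l) ℤ.- A (k + suc (suc (suc z)))) (ℕ.+-suc n i)))
        where
        eq′ : suc i + l ≡ n
        eq′ = trans (sym (ℕ.+-suc i l)) eq

    wave-step : ∀ k {y z} → Wave A (suc k) y → NegWave A k z →
                Wave A (suc (suc k)) (λ p → z p ℤ.+ neighbours m y p)
    wave-step k {y} {z} wave negWave i l eq =
      trans (cong₂ ℤ._+_ (negWave i l eq)
              (cong₂ ℤ._+_ (trans (left (suc k) y i l eq wave) (cong₂ (λ a b → A a ℤ.- A b) (e₁ k l) (e₂ k n i)))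
                           (trans (right (suc k) y i l eq wave) (cong₂ (λ a b → A a ℤ.- A b) (e₃ k l) (e₄ k n i)))))
        (cancel (A (k + suc l)) (A (k + suc (suc (suc (n + i)))))
                (A (suc (suc k) + suc l)) (A (suc (suc k) + suc (suc (suc (n + i))))))
      where
      cancel : ∀ a b c d → ℤ.- (a ℤ.- b) ℤ.+ ((c ℤ.- b) ℤ.+ (a ℤ.- d)) ≡ c ℤ.- d
      cancel = ℤ-Solver.solve-∀
      e₁ : ∀ k l → suc k + suc (suc l) ≡ suc (suc k) + suc l
      e₁ = ℕ-Solver.solve-∀
      e₂ : ∀ k n i → suc k + suc (suc (n + i)) ≡ k + suc (suc (suc (n + i)))
      e₂ = ℕ-Solver.solve-∀
      e₃ : ∀ k l → suc k + l ≡ k + suc l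
      e₃ = ℕ-Solver.solve-∀
      e₄ : ∀ k n i → suc k + suc (suc (suc (suc (n + i)))) ≡ suc (suc k) + suc (suc (suc (n + i)))
      e₄ = ℕ-Solver.solve-∀

    travelling-periodic : ∀ k i l → travelling A (m + m + k) i l ≡ travelling A k i l
    travelling-periodic k i l = cong₂ ℤ._-_ (trans (cong A (swap (m + m) k _)) (period _))
                                            (trans (cong A (swap (m + m) k _)) (period _))
      where
      swap : ∀ a b c → a + b + c ≡ b + c + a
      swap = ℕ-Solver.solve-∀

    -- The two terms of `travelling` are sampled at indices that differ by the even number 2 (i +
    -- 1), so over r < m both run through the same residues modulo 2 m and their sums cancel.
    wave-sum : ∀ h i l → i + l ≡ n → sum< m (λ r → travelling A (h + (r + r)) i l) ≡ 0ℤ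
    wave-sum h i l refl =
      trans (sum<-minus m _ _)
        (trans (cong₂ ℤ._-_ (sum<-cong m λ r → cong A (e₁ h r l)) (sum<-cong m λ r → cong A (e₂ h r i l)))
        (trans (cong (λ z → sum< m (double (h + suc l)) ℤ.- z) (sum<-shift (h + suc l) (suc i)))
               (ℤ.+-inverseʳ (sum< m (double (h + suc l))))))
      where
      open Periodic A m period
      e₁ : ∀ h r l → h + (r + r) + suc l ≡ h + suc l + (r + r)
      e₁ = ℕ-Solver.solve-∀
      e₂ : ∀ h r i l → h + (r + r) + suc (suc (suc (i + l + i))) ≡ h + suc l + (suc i + suc i) + (r + r)
      e₂ = ℕ-Solver.solve-∀

  -- Solves - y₀ j = A (m - j) - A (m + j) and y₁ j = A (m + 1 - j) - A (m + 1 + j),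
  -- with low j = A (m - j) and high j = A (m + 1 + j).
  module Initial (y₀ y₁ : ℕ → ℤ) where
    low high : ℕ → ℤ
    low  zero    = 0ℤ
    low  (suc i) = high i ℤ.- y₀ (at i)
    high zero    = 0ℤ
    high (suc i) = low i ℤ.- y₁ (at i)

    -- `low` and `high` determine A on 1, ..., 2 m, and `B i` is the value at i + 1; index 0
    -- therefore takes the value at 2 m. Only differences of A at indices of equal parity are
    -- prescribed, so A m and A (m + 1) are free and were set to 0.
    B : ℕ → ℤ
    B i with i ℕ.≤? suc n
    ... | yes _ = low (suc n ∸ i)
    ... | no  _ = high (i ∸ m)

    A : ℕ → ℤ
    A zero    = B (suc n + m)
    A (suc i) = B (i % (m + m))

    period : ∀ k → A (k + (m + m)) ≡ A k
    period zero    = cong B (ℕ.m<n⇒m%n≡m (ℕ.≤-refl {m + m}))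
    period (suc k) = cong B (ℕ.[m+n]%n≡m%n k (m + m))

    A-low : ∀ i l → i + l ≡ suc n → A (suc l) ≡ low i
    A-low i l eq = trans (cong B (ℕ.m<n⇒m%n≡m (ℕ.≤-trans (s≤s l≤) (ℕ.m≤m+n m m)))) B-low
      where
      l≤ : l ≤ suc n
      l≤ = subst (l ≤_) eq (ℕ.m≤n+m l i)
      B-low : B l ≡ low i
      B-low with l ℕ.≤? suc n
      ... | yes _   = cong low (trans (cong (_∸ l) (sym eq)) (ℕ.m+n∸n≡m i l))
      ... | no l≰   = contradiction l≤ l≰

    A-high : ∀ i → i ≤ suc n → A (suc (m + i)) ≡ high i
    A-high i i≤ = trans (cong B (ℕ.m<n⇒m%n≡m (ℕ.+-monoʳ-< m (s≤s i≤)))) B-high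
      where
      B-high : B (m + i) ≡ high i
      B-high with (m + i) ℕ.≤? suc n
      ... | yes m+i≤ = contradiction (ℕ.≤-trans (ℕ.m≤m+n m i) m+i≤) (ℕ.<⇒≱ ℕ.≤-refl)
      ... | no _     = cong high (ℕ.m+n∸m≡n m i)

    wave₁ : Wave A 1 y₁
    wave₁ i l refl = sym (trans
      (cong₂ ℤ._-_ (A-low i (suc l) (ℕ.+-suc i l))
                   (trans (cong A (e i l)) (A-high (suc i) (s≤s (ℕ.m≤m+n i l)))))
      (cancel (low i) (y₁ (at i))))
      where
      e : ∀ i l → suc (suc (suc (suc (i + l + i)))) ≡ suc (suc (suc (i + l)) + suc i)
      e = ℕ-Solver.solve-∀
      cancel : ∀ a b → a ℤ.- (a ℤ.- b) ≡ b
      cancel = ℤ-Solver.solve-∀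

    negWave₀ : NegWave A 0 y₀
    negWave₀ i l refl = sym (trans
      (cong ℤ.-_ (cong₂ ℤ._-_ (A-low (suc i) l refl) (A-high i (ℕ.m≤n⇒m≤1+n (ℕ.m≤m+n i l)))))
      (cancel (high i) (y₀ (at i))))
      where
      cancel : ∀ a b → ℤ.- ((a ℤ.- b) ℤ.- a) ≡ b
      cancel = ℤ-Solver.solve-∀

-- A reflection representation over ℤ in which 2 cos (π / m) is replaced by the operator
-- neighbours m on functions ℕ → ℤ.
module ReflectionRepresentation {s} {S : Set s} (_≟_ : DecidableEquality S) (M : CoxeterMatrix S) where
  open CoxeterMatrix M

  V : Set s
  V = S → ℕ → ℤ

  infix 4 _≋_
  _≋_ : V → V → Set s
  f ≋ g = ∀ u → f u ≗ g u

  -- The contragredient of the geometric representation: `f` is a functional given by its values on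
  -- the simple roots, and s α_u = α_u + 2 cos(π/m) α_s for u ≠ s.
  reflect : S → V → V
  reflect s f u p with u ≟ s
  ... | yes _ = ℤ.- f s p
  ... | no  _ = f u p ℤ.+ neighbours (m s u) (f s) p

  reflect-same : ∀ s f p → reflect s f s p ≡ ℤ.- f s p
  reflect-same s f p with s ≟ s
  ... | yes _  = refl
  ... | no s≢s = contradiction refl s≢s

  reflect-other : ∀ {s u} → ¬ u ≡ s → ∀ f p → reflect s f u p ≡ f u p ℤ.+ neighbours (m s u) (f s) p
  reflect-other {s} {u} u≢s f p with u ≟ s
  ... | yes u≡s = contradiction u≡s u≢s
  ... | no  _   = refl

  reflect-cong : ∀ s {f g} → f ≋ g → reflect s f ≋ reflect s g
  reflect-cong s f≋g u p with u ≟ s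
  ... | yes _ = cong ℤ.-_ (f≋g s p)
  ... | no  _ = cong₂ ℤ._+_ (f≋g u p) (neighbours-cong (m s u) (f≋g s) p)

  reflect-involutive : ∀ s f → reflect s (reflect s f) ≋ f
  reflect-involutive s f u p with u ≟ s
  ... | yes refl = trans (cong ℤ.-_ (reflect-same s f p)) (ℤ.neg-involutive (f s p))
  ... | no  u≢s  = trans (cong₂ ℤ._+_ (reflect-other u≢s f p) (neighbours-cong (m s u) (reflect-same s f) p))
      (trans (ℤ.+-assoc (f u p) _ _) (trans (cong (λ z → f u p ℤ.+ z) vanish) (ℤ.+-identityʳ _)))
    where
    vanish : neighbours (m s u) (f s) p ℤ.+ neighbours (m s u) (λ i → ℤ.- f s i) p ≡ 0ℤ
    vanish = trans (sym (neighbours-+ (m s u) (f s) _ p))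
      (trans (neighbours-cong (m s u) (λ i → ℤ.+-inverseʳ (f s i)) p) (neighbours-0 (m s u) p))

  apply : List S → V → V
  apply u f = foldr reflect f u

  apply-cong : ∀ u {f g} → f ≋ g → apply u f ≋ apply u g
  apply-cong []      f≋g = f≋g
  apply-cong (s ∷ u) f≋g = reflect-cong s (apply-cong u f≋g)

  module Dihedral (s t : S) (s≢t : ¬ s ≡ t) (n : ℕ) (mst : m s t ≡ suc (suc n)) (f : V) where
    rounds : ℕ → V
    rounds k = apply (concat (replicate k (s ∷ t ∷ []))) f

    t≢s : ¬ t ≡ s
    t≢s t≡s = s≢t (sym t≡s)

    half : ℕ → V
    half k = reflect t (rounds k)

    module _ (q : ℕ) where
      open Component n q using (at; Wave; NegWave; wave-step)
      open Component.Initial n q (f s) (f t)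

      -- Each reflection negates one of the two coordinates and adds the neighbours of its old value
      -- to the other, which is one step of x (k + 2) = neighbours (x (k + 1)) - x k. After a whole
      -- round the t-coordinate carries the wave at an odd time, and the s-coordinate, just negated,
      -- minus the wave at the even time before it.
      waves : ∀ k → Wave A (suc (k + k)) (rounds k t) × NegWave A (k + k) (rounds k s)
      wave-half : ∀ k → Wave A (suc (suc (k + k))) (half k s)

      wave-half k i l eq = trans (reflect-other s≢t (rounds k) (at i))
        (trans (cong (λ z → rounds k s (at i) ℤ.+ neighbours z (rounds k t) (at i)) (trans (m-sym t s) mst))
               (wave-step A period (k + k) {rounds k t} {rounds k s} (proj₁ (waves k)) (proj₂ (waves k)) i l eq))

      waves zero    = wave₁ , negWave₀
      waves (suc k) = subst (λ j → Wave A (suc j) (rounds (suc k) t) × NegWave A j (rounds (suc k) s)) (cong suc (sym (ℕ.+-suc k k)))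
        ( (λ i l eq → trans (reflect-other t≢s (half k) (at i))
            (trans (cong (λ z → half k t (at i) ℤ.+ neighbours z (half k s) (at i)) mst)
            (wave-step A period (suc (k + k)) {half k s} {half k t} (wave-half k)
              (λ i l eq → trans (reflect-same t (rounds k) (at i)) (cong ℤ.-_ (proj₁ (waves k) i l eq))) i l eq)))
        , (λ i l eq → trans (reflect-same s (half k) (at i)) (cong ℤ.-_ (wave-half k i l eq))))

    sum-t sum-s : ℕ → ℕ → ℤ
    sum-t k p = sum< k (λ r → rounds r t p)
    sum-s k p = sum< k (λ r → half r s p)

    -- The other coordinates never feed back into those of s and t. They only accumulate, so by
    -- linearity their return to `f u` comes down to the vanishing of two sums over a period.
    rounds-other : ∀ {u} → ¬ u ≡ s → ¬ u ≡ t → ∀ k p →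
      rounds k u p ≡ f u p ℤ.+ (neighbours (m t u) (sum-t k) p ℤ.+ neighbours (m s u) (sum-s k) p)
    rounds-other {u} u≢s u≢t zero p = sym (trans
      (cong (λ z → f u p ℤ.+ z) (cong₂ ℤ._+_ (neighbours-0 (m t u) p) (neighbours-0 (m s u) p))) (ℤ.+-identityʳ _))
    rounds-other {u} u≢s u≢t (suc k) p =
      trans (reflect-other u≢s (half k) p)
        (trans (cong (ℤ._+ neighbours (m s u) (half k s) p)
                 (trans (reflect-other u≢t (rounds k) p)
                        (cong (ℤ._+ neighbours (m t u) (rounds k t) p) (rounds-other u≢s u≢t k p))))
        (trans (shuffle (f u p) (neighbours (m t u) (sum-t k) p) (neighbours (m s u) (sum-s k) p) _ _)
        (cong (λ z → f u p ℤ.+ z) (sym (cong₂ ℤ._+_ (neighbours-+ (m t u) (sum-t k) (rounds k t) p)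
                                                    (neighbours-+ (m s u) (sum-s k) (half k s) p))))))
      where
      shuffle : ∀ a b c d e → a ℤ.+ (b ℤ.+ c) ℤ.+ d ℤ.+ e ≡ a ℤ.+ ((b ℤ.+ d) ℤ.+ (c ℤ.+ e))
      shuffle = ℤ-Solver.solve-∀

    position : ∀ p → p ≡ p % suc n + p / suc n * suc n
    position p = ℕ.m≡m%n+[m/n]*n p (suc n)

    rest : ∀ p → p % suc n + (n ∸ p % suc n) ≡ n
    rest p = ℕ.m+[n∸m]≡n (ℕ.≤-pred (ℕ.m%n<n p (suc n)))

    period-sum-t : ∀ p → sum-t (suc (suc n)) p ≡ 0ℤ
    period-sum-t p = trans (cong (sum-t (suc (suc n))) (position p))
      (trans (sum<-cong (suc (suc n)) (λ r → proj₁ (waves q r) _ _ (rest p)))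
             (Component.wave-sum n q _ (Component.Initial.period n q (f s) (f t)) 1 _ _ (rest p)))
      where
      q = p / suc n

    period-sum-s : ∀ p → sum-s (suc (suc n)) p ≡ 0ℤ
    period-sum-s p = trans (cong (sum-s (suc (suc n))) (position p))
      (trans (sum<-cong (suc (suc n)) (λ r → wave-half q r _ _ (rest p)))
             (Component.wave-sum n q _ (Component.Initial.period n q (f s) (f t)) 2 _ _ (rest p)))
      where
      q = p / suc n

    order : rounds (suc (suc n)) ≋ f
    order u p = cases (u ≟ s) (u ≟ t)
      where
      cases : Dec (u ≡ s) → Dec (u ≡ t) → rounds (suc (suc n)) u p ≡ f u p
      cases (yes refl) _ = trans (cong (rounds (suc (suc n)) s) (position p))
          (trans (proj₂ (waves q (suc (suc n))) i l (rest p))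
          (trans (cong ℤ.-_ (trans (cong (λ k → travelling A k i l) (sym (ℕ.+-identityʳ (m′ + m′))))
                                   (travelling-periodic A period 0 i l)))
          (trans (sym (negWave₀ i l (rest p))) (cong (f s) (sym (position p))))))
        where
        q = p / suc n
        i = p % suc n
        l = n ∸ i
        open Component n q renaming (m to m′)
        open Component.Initial n q (f s) (f t)
      cases (no _) (yes refl) = trans (cong (rounds (suc (suc n)) t) (position p))
          (trans (proj₁ (waves q (suc (suc n))) i l (rest p))
          (trans (trans (cong (λ k → travelling A k i l) (ℕ.+-comm 1 (m′ + m′)))
                        (travelling-periodic A period 1 i l))
          (trans (sym (wave₁ i l (rest p))) (cong (f t) (sym (position p))))))
        where
        q = p / suc n
        i = p % suc n
        l = n ∸ i
        open Component n q renaming (m to m′)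
        open Component.Initial n q (f s) (f t)
      cases (no u≢s) (no u≢t) = trans (rounds-other u≢s u≢t (suc (suc n)) p)
        (trans (cong (λ z → f u p ℤ.+ z) (cong₂ ℤ._+_
            (trans (neighbours-cong (m t u) period-sum-t p) (neighbours-0 (m t u) p))
            (trans (neighbours-cong (m s u) period-sum-s p) (neighbours-0 (m s u) p))))
          (ℤ.+-identityʳ _))

  relation : ∀ s t f → apply (concat (replicate (m s t) (s ∷ t ∷ []))) f ≋ f
  relation s t f with m s t in mst
  ... | zero        = λ u p → refl
  ... | suc zero    with refl ← Equivalence.to (m≡1 s t) mst = reflect-involutive s f
  ... | suc (suc n) = Dihedral.order s t s≢t n mst f
    where
    s≢t : ¬ s ≡ t
    s≢t s≡t with () ← trans (sym mst) (Equivalence.from (m≡1 s t) s≡t)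

  ≋-setoid : Setoid s s
  ≋-setoid = record
    { Carrier = V ; _≈_ = _≋_
    ; isEquivalence = record
      { refl  = λ u p → refl
      ; sym   = λ f≋g u p → sym (f≋g u p)
      ; trans = λ f≋g g≋h u p → trans (f≋g u p) (g≋h u p) } }

  apply-congruence : ∀ f {u v} → CoxeterCongruence M u v → apply u f ≋ apply v f
  apply-congruence f = EqClosure.gfold (Setoid.isEquivalence ≋-setoid) (λ u → apply u f) invariant
    where
    invariant : ∀ {u v} → Relator M u v → apply u f ≋ apply v f
    invariant (relator u s t v) = λ x p → trans
      (cong (λ g → g x p) (foldr-++ reflect f u _))
      (trans (apply-cong u (λ x p → trans
               (cong (λ g → g x p) (foldr-++ reflect f (concat (replicate (m s t) (s ∷ t ∷ []))) v))
               (relation s t (apply v f) x p)) x p)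
             (cong (λ g → g x p) (sym (foldr-++ reflect f u v))))

  -- The indicator of s separates the two: s negates its value at s, while t leaves that value
  -- unchanged because the indicator vanishes at t.
  generators-distinct : ∀ {s t} → CoxeterCongruence M (s ∷ []) (t ∷ []) → s ≡ t
  generators-distinct {s} {t} s∼t with s ≟ t
  ... | yes s≡t = s≡t
  ... | no  s≢t = contradiction (begin
      ℤ.- δ s 0                                    ≡⟨ reflect-same s δ 0 ⟨
      reflect s δ s 0                              ≡⟨ apply-congruence δ s∼t s 0 ⟩
      reflect t δ s 0                              ≡⟨ reflect-other s≢t δ 0 ⟩
      δ s 0 ℤ.+ neighbours (m t s) (δ t) 0         ≡⟨ cong (λ z → δ s 0 ℤ.+ z) (trans
                                                        (neighbours-cong (m t s) (λ _ → δ-other) 0)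
                                                        (neighbours-0 (m t s) 0)) ⟩
      δ s 0 ℤ.+ 0ℤ                                 ∎)
      (subst (λ z → ¬ ℤ.- z ≡ z ℤ.+ 0ℤ) (sym δ-same) λ ())
    where
    open ≡-Reasoning
    δ : V
    δ u _ with u ≟ s
    ... | yes _ = 1ℤ
    ... | no  _ = 0ℤ
    δ-same : δ s 0 ≡ 1ℤ
    δ-same with s ≟ s
    ... | yes _  = refl
    ... | no s≢s = contradiction refl s≢s
    δ-other : ∀ {p} → δ t p ≡ 0ℤ
    δ-other with t ≟ s
    ... | yes t≡s = contradiction (sym t≡s) s≢t
    ... | no  _   = refl

module CoxeterTheory (em : ∀ {a} → ExcludedMiddle a) {c e s : Level} (C : CoxeterSystem c e s) where
  open CoxeterSystem C
  open Coxeter em C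
  open CoxeterMatrix matrix using (m; m≡1)
  open Membership setoid using () renaming (_∈_ to _∈ₗ_)
  open Propositional using () renaming (_∈_ to _∈ˢ_)
  open GroupSolver group using (solve; _⊜_; _⊕_; ⊖_; 𝟙)
  open import Algebra.Properties.Group group
    using (∙-cancelˡ; ∙-cancelʳ; inverseʳ-unique; ⁻¹-anti-homo-∙; ⁻¹-involutive; ε⁻¹≈ε)
  open import Algebra.Properties.Monoid.Mult monoid using (×-homo-+) renaming (_×_ to _⋯_)
  open import Relation.Binary.Reasoning.Setoid setoid hiding (start; stop)


  -- Words and the length function

  gen-distinct : ∀ {s t} → gen s ≈ gen t → s ≡ t
  gen-distinct {s} {t} s≈t = ReflectionRepresentation.generators-distinct (λ _ _ → em) matrix
    (Equivalence.to (presented (s ∷ []) (t ∷ [])) (∙-congʳ s≈t))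

  ⟦++⟧ : ∀ u v → ⟦ u ++ v ⟧ ≈ ⟦ u ⟧ ∙ ⟦ v ⟧
  ⟦++⟧ []      v = ≈-sym (identityˡ _)
  ⟦++⟧ (s ∷ u) v = ≈-trans (∙-congˡ (⟦++⟧ u v)) (≈-sym (assoc _ _ _))

  alternating : S → S → ℕ → List S
  alternating s t k = concat (replicate k (s ∷ t ∷ []))

  ⟦alternating⟧ : ∀ s t k → ⟦ alternating s t k ⟧ ≈ k ⋯ (gen s ∙ gen t)
  ⟦alternating⟧ s t zero    = ≈-refl
  ⟦alternating⟧ s t (suc k) = ≈-trans (≈-sym (assoc _ _ _)) (∙-congˡ (⟦alternating⟧ s t k))

  braid : ∀ s t → m s t ⋯ (gen s ∙ gen t) ≈ ε
  braid s t = ≈-trans (≈-sym (⟦alternating⟧ s t (m s t)))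
    (Equivalence.from (presented _ [])
      (subst (λ u → CoxeterCongruence matrix u []) (++-identityʳ (alternating s t (m s t)))
        (EqClosure.return (relator [] s t []))))

  gen² : ∀ s → gen s ∙ gen s ≈ ε
  gen² s = ≈-trans (≈-sym (identityʳ _))
    (subst (λ k → k ⋯ (gen s ∙ gen s) ≈ ε) (Equivalence.from (m≡1 s s) ≡.refl) (braid s s))

  gen⁻¹ : ∀ s → gen s ⁻¹ ≈ gen s
  gen⁻¹ s = ≈-sym (inverseʳ-unique _ _ (gen² s))

  gen-cancelˡ : ∀ s x → gen s ∙ (gen s ∙ x) ≈ x
  gen-cancelˡ s x = ≈-trans (≈-sym (assoc _ _ _)) (≈-trans (∙-congʳ (gen² s)) (identityˡ x))

  gen-cancelʳ : ∀ s x → x ∙ gen s ∙ gen s ≈ x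
  gen-cancelʳ s x = ≈-trans (assoc _ _ _) (≈-trans (∙-congˡ (gen² s)) (identityʳ x))

  ⟦reducedWord⟧ : ∀ w → ⟦ reducedWord w ⟧ ≈ w
  ⟦reducedWord⟧ w = proj₁ (proj₂ (shortest-exists w))

  ℓ-word : ∀ u {w} → ⟦ u ⟧ ≈ w → ℓ w ≤ length u
  ℓ-word u {w} u≈w = proj₂ (proj₂ (shortest-exists w)) u u≈w

  ℓ-cong : ∀ {x y} → x ≈ y → ℓ x ≡ ℓ y
  ℓ-cong x≈y = ℕ.≤-antisym (ℓ-mono x≈y) (ℓ-mono (≈-sym x≈y))

  ℓ-∙ : ∀ x y → ℓ (x ∙ y) ≤ ℓ x + ℓ y
  ℓ-∙ x y = subst (ℓ (x ∙ y) ≤_) (length-++ (reducedWord x) {reducedWord y})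
    (ℓ-word (reducedWord x ++ reducedWord y) (≈-trans (⟦++⟧ (reducedWord x) (reducedWord y)) (∙-cong (⟦reducedWord⟧ x) (⟦reducedWord⟧ y))))

  ℓ-ε : ℓ ε ≡ 0
  ℓ-ε = ℕ.n≤0⇒n≡0 (ℓ-word [] ≈-refl)

  ℓ≡0⇒ε : ∀ w → ℓ w ≡ 0 → w ≈ ε
  ℓ≡0⇒ε w ℓ≡0 with reducedWord w in eq
  ... | [] = ≈-trans (≈-sym (⟦reducedWord⟧ w)) (reflexive (cong ⟦_⟧ eq))

  ℓ-gen : ∀ s → ℓ (gen s) ≤ 1
  ℓ-gen s = ℓ-word (s ∷ []) (identityʳ _)

  ⟦reverse⟧ : ∀ u → ⟦ reverse u ⟧ ≈ ⟦ u ⟧ ⁻¹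
  ⟦reverse⟧ []      = ≈-sym ε⁻¹≈ε
  ⟦reverse⟧ (s ∷ u) = begin
    ⟦ reverse (s ∷ u) ⟧         ≡⟨ cong ⟦_⟧ (unfold-reverse s u) ⟩
    ⟦ reverse u ∷ʳ s ⟧          ≈⟨ ⟦++⟧ (reverse u) (s ∷ []) ⟩
    ⟦ reverse u ⟧ ∙ (gen s ∙ ε) ≈⟨ ∙-cong (⟦reverse⟧ u) (≈-trans (identityʳ _) (≈-sym (gen⁻¹ s))) ⟩
    ⟦ u ⟧ ⁻¹ ∙ gen s ⁻¹         ≈⟨ ⁻¹-anti-homo-∙ _ _ ⟨
    (gen s ∙ ⟦ u ⟧) ⁻¹          ∎

  ℓ-⁻¹ : ∀ w → ℓ (w ⁻¹) ≡ ℓ w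
  ℓ-⁻¹ w = ℕ.≤-antisym (half w) (subst (_≤ ℓ (w ⁻¹)) (ℓ-cong (⁻¹-involutive w)) (half (w ⁻¹)))
    where
    half : ∀ w → ℓ (w ⁻¹) ≤ ℓ w
    half w = subst (ℓ (w ⁻¹) ≤_) (length-reverse (reducedWord w))
      (ℓ-word (reverse (reducedWord w)) (≈-trans (⟦reverse⟧ (reducedWord w)) (⁻¹-cong (⟦reducedWord⟧ w))))

  -- The reflection cocycle

  δ : Carrier → Carrier → Bool
  δ x y = does (em {P = x ≈ y})

  δ-⇔ : ∀ {w x y z} → (w ≈ x → y ≈ z) → (y ≈ z → w ≈ x) → δ w x ≡ δ y z
  δ-⇔ to from = does-⇔ (mk⇔ to from) em em

  δ-translate : ∀ {x y x′ y′} g h → x′ ≈ g ∙ x ∙ h → y′ ≈ g ∙ y ∙ h → δ x y ≡ δ x′ y′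
  δ-translate g h x′≈ y′≈ = δ-⇔
    (λ x≈y → ≈-trans x′≈ (≈-trans (∙-congʳ (∙-congˡ x≈y)) (≈-sym y′≈)))
    (λ x′≈y′ → ∙-cancelˡ g _ _ (∙-cancelʳ h _ _ (≈-trans (≈-sym x′≈) (≈-trans x′≈y′ y′≈))))

  δ-yes : ∀ {x y} → x ≈ y → δ x y ≡ true
  δ-yes {x} {y} x≈y with em {P = x ≈ y}
  ... | yes _  = ≡.refl
  ... | no x≉y = contradiction x≈y x≉y

  δ-no : ∀ {x y} → ¬ x ≈ y → δ x y ≡ false
  δ-no {x} {y} x≉y with em {P = x ≈ y}
  ... | yes x≈y = contradiction x≈y x≉y
  ... | no _    = ≡.refl

  -- The parity of the number of i with x = s₁ ⋯ sᵢ₋₁ sᵢ sᵢ₋₁ ⋯ s₁, for a word s₁ ⋯ sₖ.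
  parity : List S → Carrier → Bool
  parity []      x = false
  parity (s ∷ u) x = δ x (gen s) xor parity u (gen s ⁻¹ ∙ x ∙ gen s)

  parity-cong : ∀ u {x y} → x ≈ y → parity u x ≡ parity u y
  parity-cong []      x≈y = ≡.refl
  parity-cong (s ∷ u) x≈y = cong₂ _xor_
    (δ-⇔ (≈-trans (≈-sym x≈y)) (≈-trans x≈y)) (parity-cong u (∙-congʳ (∙-congˡ x≈y)))

  parity-++ : ∀ u v x → parity (u ++ v) x ≡ parity u x xor parity v (⟦ u ⟧ ⁻¹ ∙ x ∙ ⟦ u ⟧)
  parity-++ [] v x = parity-cong v (solve 1 (λ x → x ⊜ ⊖ 𝟙 ⊕ x ⊕ 𝟙) ≈-refl x)
  parity-++ (s ∷ u) v x = ≡.trans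
    (cong (δ x (gen s) xor_) (≡.trans (parity-++ u v _)
      (cong (parity u (gen s ⁻¹ ∙ x ∙ gen s) xor_) (parity-cong v
        (solve 3 (λ s u x → ⊖ u ⊕ (⊖ s ⊕ x ⊕ s) ⊕ u ⊜ ⊖ (s ⊕ u) ⊕ x ⊕ (s ⊕ u)) ≈-refl (gen s) ⟦ u ⟧ x)))))
    (≡.sym (xor-assoc (δ x (gen s)) _ _))

  module _ (s t : S) where
    private
      d : Carrier
      d = gen s ∙ gen t

    pow-suc : ∀ i → suc i ⋯ d ≈ i ⋯ d ∙ d
    pow-suc i = begin
      suc i ⋯ d         ≡⟨ cong (_⋯ d) (ℕ.+-comm 1 i) ⟩
      (i + 1) ⋯ d       ≈⟨ ×-homo-+ d i 1 ⟩
      i ⋯ d ∙ (d ∙ ε)   ≈⟨ ∙-congˡ (identityʳ d) ⟩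
      i ⋯ d ∙ d         ∎

    pow-inverse : ∀ i → gen s ∙ (i ⋯ d) ⁻¹ ≈ i ⋯ d ∙ gen s
    pow-inverse zero    = solve 1 (λ s → s ⊕ ⊖ 𝟙 ⊜ 𝟙 ⊕ s) ≈-refl (gen s)
    pow-inverse (suc i) = begin
      gen s ∙ (gen s ∙ gen t ∙ i ⋯ d) ⁻¹
        ≈⟨ solve 3 (λ s t p → s ⊕ ⊖ (s ⊕ t ⊕ p) ⊜ s ⊕ ⊖ p ⊕ (⊖ t ⊕ ⊖ s)) ≈-refl _ _ _ ⟩
      gen s ∙ (i ⋯ d) ⁻¹ ∙ (gen t ⁻¹ ∙ gen s ⁻¹)
        ≈⟨ ∙-cong (pow-inverse i) (∙-cong (gen⁻¹ t) (gen⁻¹ s)) ⟩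
      i ⋯ d ∙ gen s ∙ (gen t ∙ gen s)
        ≈⟨ solve 3 (λ s t p → p ⊕ s ⊕ (t ⊕ s) ⊜ p ⊕ (s ⊕ t) ⊕ s) ≈-refl _ _ _ ⟩
      i ⋯ d ∙ d ∙ gen s
        ≈⟨ ∙-congʳ (pow-suc i) ⟨
      suc i ⋯ d ∙ gen s ∎

    -- An element x is the reflection (st)ʲ s exactly when x s = (st)ʲ. Taking x s for `z` turns
    -- reflections into powers of st, which are periodic in the exponent.
    count : ℕ → ℕ → Carrier → Bool
    count a zero    z = false
    count a (suc n) z = δ z (a ⋯ d) xor count (suc a) n z

    -- The reflections along (st)ᵏ are the (st)ʲ s with j < 2 k.
    parity-alternating : ∀ k i x y → x ≈ i ⋯ d ∙ y ∙ (i ⋯ d) ⁻¹ →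
      parity (alternating s t k) y ≡ count (i + i) (k + k) (x ∙ gen s)
    parity-alternating zero    i x y x≈ = ≡.refl
    parity-alternating (suc k) i x y x≈ rewrite ℕ.+-suc k k = cong₂ _xor_
      (δ-translate p (p ⁻¹ ∙ gen s)
        (≈-trans (∙-congʳ x≈) (assoc _ _ _))
        (begin
          (i + i) ⋯ d                  ≈⟨ ×-homo-+ d i i ⟩
          p ∙ p                        ≈⟨ gen-cancelʳ s _ ⟨
          p ∙ p ∙ gen s ∙ gen s        ≈⟨ ∙-congʳ (assoc _ _ _) ⟩
          p ∙ (p ∙ gen s) ∙ gen s      ≈⟨ ∙-congʳ (∙-congˡ (pow-inverse i)) ⟨
          p ∙ (gen s ∙ p ⁻¹) ∙ gen s   ≈⟨ solve 2 (λ p s → p ⊕ (s ⊕ ⊖ p) ⊕ s ⊜ p ⊕ s ⊕ (⊖ p ⊕ s)) ≈-refl _ _ ⟩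
          p ∙ gen s ∙ (p ⁻¹ ∙ gen s)   ∎))
      (cong₂ _xor_
        (δ-translate (p ∙ gen s) (gen s ⁻¹ ∙ (p ⁻¹ ∙ gen s))
          (begin
            x ∙ gen s                  ≈⟨ ∙-congʳ x≈ ⟩
            p ∙ y ∙ p ⁻¹ ∙ gen s       ≈⟨ solve 3 (λ p s y → p ⊕ y ⊕ ⊖ p ⊕ s ⊜
                                           p ⊕ s ⊕ (⊖ s ⊕ y ⊕ s) ⊕ (⊖ s ⊕ (⊖ p ⊕ s))) ≈-refl _ _ _ ⟩
            p ∙ gen s ∙ (gen s ⁻¹ ∙ y ∙ gen s) ∙ (gen s ⁻¹ ∙ (p ⁻¹ ∙ gen s)) ∎)
          (begin
            suc (i + i) ⋯ d                            ≈⟨ ×-homo-+ d (suc i) i ⟩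
            suc i ⋯ d ∙ p                              ≈⟨ ∙-congʳ (pow-suc i) ⟩
            p ∙ d ∙ p                                  ≈⟨ gen-cancelʳ s _ ⟨
            p ∙ d ∙ p ∙ gen s ∙ gen s                  ≈⟨ ∙-congʳ (assoc _ _ _) ⟩
            p ∙ d ∙ (p ∙ gen s) ∙ gen s                ≈⟨ ∙-congʳ (∙-congˡ (pow-inverse i)) ⟨
            p ∙ d ∙ (gen s ∙ p ⁻¹) ∙ gen s             ≈⟨ ∙-congʳ (∙-congˡ (∙-congʳ (gen⁻¹ s))) ⟨
            p ∙ d ∙ (gen s ⁻¹ ∙ p ⁻¹) ∙ gen s          ≈⟨ solve 3 (λ p s t → p ⊕ (s ⊕ t) ⊕ (⊖ s ⊕ ⊖ p) ⊕ s ⊜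
                                                            p ⊕ s ⊕ t ⊕ (⊖ s ⊕ (⊖ p ⊕ s))) ≈-refl _ _ _ ⟩
            p ∙ gen s ∙ gen t ∙ (gen s ⁻¹ ∙ (p ⁻¹ ∙ gen s)) ∎))
        (≡.trans
          (parity-alternating k (suc i) x _ (begin
            x                 ≈⟨ x≈ ⟩
            p ∙ y ∙ p ⁻¹      ≈⟨ solve 4 (λ p s t y → p ⊕ y ⊕ ⊖ p ⊜
                                   p ⊕ (s ⊕ t) ⊕ (⊖ t ⊕ (⊖ s ⊕ y ⊕ s) ⊕ t) ⊕ ⊖ (p ⊕ (s ⊕ t))) ≈-refl _ _ _ _ ⟩
            p ∙ d ∙ y′ ∙ (p ∙ d) ⁻¹ ≈⟨ ∙-cong (∙-congʳ (pow-suc i)) (⁻¹-cong (pow-suc i)) ⟨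
            suc i ⋯ d ∙ y′ ∙ (suc i ⋯ d) ⁻¹ ∎))
          (cong (λ j → count j (k + k) (x ∙ gen s)) (cong suc (ℕ.+-suc i i)))))
      where
      p y′ : Carrier
      p  = i ⋯ d
      y′ = gen t ⁻¹ ∙ (gen s ⁻¹ ∙ y ∙ gen s) ∙ gen t

    count-+ : ∀ a n k z → count a (n + k) z ≡ count a n z xor count (n + a) k z
    count-+ a zero    k z = ≡.refl
    count-+ a (suc n) k z = ≡.trans (cong (δ z (a ⋯ d) xor_) (≡.trans (count-+ (suc a) n k z)
        (cong (λ j → count (suc a) n z xor count j k z) (ℕ.+-suc n a))))
      (≡.sym (xor-assoc (δ z (a ⋯ d)) _ _))

    count-periodic : ∀ a n z → count (m s t + a) n z ≡ count a n z
    count-periodic a zero    z = ≡.refl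
    count-periodic a (suc n) z = cong₂ _xor_
      (δ-⇔ (λ z≈ → ≈-trans z≈ period) (λ z≈ → ≈-trans z≈ (≈-sym period)))
      (≡.trans (cong (λ j → count j n z) (≡.sym (ℕ.+-suc (m s t) a))) (count-periodic (suc a) n z))
      where
      period : (m s t + a) ⋯ d ≈ a ⋯ d
      period = ≈-trans (×-homo-+ d (m s t) a) (≈-trans (∙-congʳ (braid s t)) (identityˡ _))

    -- The 2 m exponents run twice through a period of m, so every element is counted an even number
    -- of times, whatever the exact order of st.
    parity-relator : ∀ x → parity (alternating s t (m s t)) x ≡ false
    parity-relator x = ≡.trans
      (parity-alternating (m s t) 0 x x (solve 1 (λ x → x ⊜ 𝟙 ⊕ x ⊕ ⊖ 𝟙) ≈-refl x))
      (≡.trans (count-+ 0 (m s t) (m s t) _)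
      (≡.trans (cong (count 0 (m s t) (x ∙ gen s) xor_) (count-periodic 0 (m s t) _))
      (xor-same (count 0 (m s t) (x ∙ gen s)))))

  parity-congruence : ∀ {u v} → CoxeterCongruence matrix u v → parity u ≗ parity v
  parity-congruence = EqClosure.gfold
    (Setoid.isEquivalence (Carrier ≡.→-setoid Bool))
    parity invariant
    where
    invariant : ∀ {u v} → Relator matrix u v → parity u ≗ parity v
    invariant (relator u s t v) x = ≡.trans (parity-++ u _ x)
      (≡.trans (cong (parity u x xor_) (≡.trans (parity-++ (alternating s t (m s t)) v _)
        (cong₂ _xor_ (parity-relator s t _) (parity-cong v (≈-trans
          (∙-cong (∙-congʳ (⁻¹-cong trivial)) trivial)
          (solve 1 (λ y → ⊖ 𝟙 ⊕ y ⊕ 𝟙 ⊜ y) ≈-refl _))))))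
        (≡.sym (parity-++ u v x)))
      where
      trivial : ⟦ alternating s t (m s t) ⟧ ≈ ε
      trivial = ≈-trans (⟦alternating⟧ s t (m s t)) (braid s t)

  η : Carrier → Carrier → Bool
  η w = parity (reducedWord w)

  η-word : ∀ u {w} → ⟦ u ⟧ ≈ w → ∀ x → parity u x ≡ η w x
  η-word u {w} u≈w = parity-congruence {u} {reducedWord w}
    (Equivalence.to (presented u (reducedWord w)) (≈-trans u≈w (≈-sym (⟦reducedWord⟧ w))))

  η-cong : ∀ {v w x y} → v ≈ w → x ≈ y → η v x ≡ η w y
  η-cong {v} {w} {x} v≈w x≈y = ≡.trans (η-word (reducedWord v) (≈-trans (⟦reducedWord⟧ v) v≈w) x) (parity-cong (reducedWord w) x≈y)

  η-ε : ∀ x → η ε x ≡ false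
  η-ε x = ≡.sym (η-word [] ≈-refl x)

  η-gen : ∀ s x → η (gen s) x ≡ δ x (gen s)
  η-gen s x = ≡.trans (≡.sym (η-word (s ∷ []) (identityʳ _) x)) (xor-identityʳ _)

  η-∙ : ∀ v w x → η (v ∙ w) x ≡ η v x xor η w (v ⁻¹ ∙ x ∙ v)
  η-∙ v w x = ≡.trans
    (≡.sym (η-word (reducedWord v ++ reducedWord w) (≈-trans (⟦++⟧ (reducedWord v) (reducedWord w)) (∙-cong (⟦reducedWord⟧ v) (⟦reducedWord⟧ w))) x))
    (≡.trans (parity-++ (reducedWord v) (reducedWord w) x)
      (cong (η v x xor_) (parity-cong (reducedWord w)
        (∙-cong (∙-congʳ (⁻¹-cong (⟦reducedWord⟧ v))) (⟦reducedWord⟧ v)))))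

  η-gen-∙ : ∀ s w x → η (gen s ∙ w) x ≡ δ x (gen s) xor η w (gen s ⁻¹ ∙ x ∙ gen s)
  η-gen-∙ s w x = ≡.trans (η-∙ (gen s) w x) (cong (_xor η w (gen s ⁻¹ ∙ x ∙ gen s)) (η-gen s x))

  -- An odd count means that x occurs among the reflections along the word, and multiplying by such
  -- a reflection deletes its letter: the strong exchange property.
  parity⇒deletion : ∀ u x → parity u x ≡ true → ∃ λ v → suc (length v) ≡ length u × ⟦ v ⟧ ≈ x ∙ ⟦ u ⟧
  parity⇒deletion (s ∷ u) x odd with em {P = x ≈ gen s}
  ... | yes x≈s = u , ≡.refl , ≈-sym (≈-trans (∙-congʳ x≈s) (gen-cancelˡ s _))
  ... | no  x≉s with v , len , v≈ ← parity⇒deletion u _ odd = s ∷ v , cong suc len ,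
    ≈-trans (∙-congˡ v≈) (solve 3 (λ s x u → s ⊕ (⊖ s ⊕ x ⊕ s ⊕ u) ⊜ x ⊕ (s ⊕ u)) ≈-refl _ _ _)

  η⇒ℓ< : ∀ w x → η w x ≡ true → ℓ (x ∙ w) < ℓ w
  η⇒ℓ< w x odd with v , len , v≈ ← parity⇒deletion (reducedWord w) x odd =
    subst (suc (ℓ (x ∙ w)) ≤_) len (s≤s (ℓ-word v (≈-trans v≈ (∙-congˡ (⟦reducedWord⟧ w)))))

  -- For t = v s v⁻¹ the cocycle rule gives η(t, t) = η(v, t) + 1 + η(v⁻¹, s), and the outer terms
  -- add up to η(v v⁻¹, t) = 0.
  reflection-η : ∀ {t} → t ∈ Reflection → η t t ≡ true
  reflection-η {t} (v , s , t≈) = begin≡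
    where
    v⁻¹tv : v ⁻¹ ∙ t ∙ v ≈ gen s
    v⁻¹tv = ≈-trans (∙-congʳ (∙-congˡ t≈)) (solve 2 (λ v s → ⊖ v ⊕ (v ⊕ s ⊕ ⊖ v) ⊕ v ⊜ s) ≈-refl v (gen s))
    sss : gen s ⁻¹ ∙ gen s ∙ gen s ≈ gen s
    sss = ≈-trans (∙-congʳ (inverseˡ _)) (identityˡ _)
    cancel : ∀ a b → a xor b ≡ false → a xor not b ≡ true
    cancel true  true  eq = ≡.refl
    cancel false false eq = ≡.refl
    begin≡ : η t t ≡ true
    begin≡ = ≡.trans (η-cong (≈-trans t≈ (assoc _ _ _)) ≈-refl)
      (≡.trans (η-∙ v (gen s ∙ v ⁻¹) t)
      (≡.trans (cong (η v t xor_) (≡.trans (η-cong ≈-refl v⁻¹tv)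
        (≡.trans (η-gen-∙ s (v ⁻¹) (gen s)) (cong₂ _xor_ (δ-yes ≈-refl) (η-cong ≈-refl sss)))))
      (cancel (η v t) (η (v ⁻¹) (gen s))
        (≡.trans (cong (η v t xor_) (η-cong ≈-refl (≈-sym v⁻¹tv)))
        (≡.trans (≡.sym (η-∙ v (v ⁻¹) t)) (≡.trans (η-cong (inverseʳ v) ≈-refl) (η-ε t)))))))

  reflection-⁻¹ : ∀ {t} → t ∈ Reflection → t ⁻¹ ≈ t
  reflection-⁻¹ {t} (v , s , t≈) = begin
    t ⁻¹                       ≈⟨ ⁻¹-cong t≈ ⟩
    (v ∙ gen s ∙ v ⁻¹) ⁻¹      ≈⟨ solve 2 (λ v s → ⊖ (v ⊕ s ⊕ ⊖ v) ⊜ v ⊕ ⊖ s ⊕ ⊖ v) ≈-refl v (gen s) ⟩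
    v ∙ gen s ⁻¹ ∙ v ⁻¹        ≈⟨ ∙-congʳ (∙-congˡ (gen⁻¹ s)) ⟩
    v ∙ gen s ∙ v ⁻¹           ≈⟨ t≈ ⟨
    t                          ∎

  reflection² : ∀ {t} → t ∈ Reflection → ∀ x → t ∙ (t ∙ x) ≈ x
  reflection² {t} t∈ x = ≈-trans (∙-congʳ (≈-sym (reflection-⁻¹ t∈)))
    (solve 2 (λ t x → ⊖ t ⊕ (t ⊕ x) ⊜ x) ≈-refl t x)

  η-false⇒ℓ< : ∀ {t} → t ∈ Reflection → ∀ w → η w t ≡ false → ℓ w < ℓ (t ∙ w)
  η-false⇒ℓ< {t} t∈ w even = subst (_< ℓ (t ∙ w)) (ℓ-cong (reflection² t∈ w))
    (η⇒ℓ< (t ∙ w) t (≡.trans (η-∙ t w t) (cong₂ _xor_ (reflection-η t∈)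
      (≡.trans (η-cong ≈-refl (≈-trans (∙-congʳ (inverseˡ t)) (identityˡ t))) even))))

  ℓ<⇒η : ∀ {t} → t ∈ Reflection → ∀ w → ℓ (t ∙ w) < ℓ w → η w t ≡ true
  ℓ<⇒η {t} t∈ w lt with η w t in eq
  ... | true  = ≡.refl
  ... | false = contradiction (η-false⇒ℓ< t∈ w eq) (ℕ.<-asym lt)

  ℓ>⇒η : ∀ t w → ℓ w < ℓ (t ∙ w) → η w t ≡ false
  ℓ>⇒η t w lt with η w t in eq
  ... | true  = contradiction (η⇒ℓ< w t eq) (ℕ.<-asym lt)
  ... | false = ≡.refl

  reflection-ℓ : ∀ {t} → t ∈ Reflection → ∀ w → ℓ w < ℓ (t ∙ w) ⊎ ℓ (t ∙ w) < ℓ w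
  reflection-ℓ {t} t∈ w with η w t in eq
  ... | true  = inj₂ (η⇒ℓ< w t eq)
  ... | false = inj₁ (η-false⇒ℓ< t∈ w eq)


  -- The Bruhat order

  ≤ᴮ-trans : ∀ {x y z} → x ≤ᴮ y → y ≤ᴮ z → x ≤ᴮ z
  ≤ᴮ-respˡ : ∀ {x y z} → x ≈ y → x ≤ᴮ z → y ≤ᴮ z
  ≤ᴮ-respʳ : ∀ {x y z} → y ≈ z → x ≤ᴮ y → x ≤ᴮ z

  ≤ᴮ-respˡ x≈y (≤ᴮ-refl x≈z)          = ≤ᴮ-refl (≈-trans (≈-sym x≈y) x≈z)
  ≤ᴮ-respˡ x≈y (≤ᴮ-step x≤ t∈ z≈ lt) = ≤ᴮ-step (≤ᴮ-respˡ x≈y x≤) t∈ z≈ lt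

  ≤ᴮ-respʳ y≈z (≤ᴮ-refl x≈y)          = ≤ᴮ-refl (≈-trans x≈y y≈z)
  ≤ᴮ-respʳ y≈z (≤ᴮ-step x≤ t∈ y≈ lt) =
    ≤ᴮ-step x≤ t∈ (≈-trans (≈-sym y≈z) y≈) (ℕ.<-≤-trans lt (ℓ-mono y≈z))

  ≤ᴮ-trans x≤y (≤ᴮ-refl y≈z)          = ≤ᴮ-respʳ y≈z x≤y
  ≤ᴮ-trans x≤y (≤ᴮ-step y≤ t∈ z≈ lt) = ≤ᴮ-step (≤ᴮ-trans x≤y y≤) t∈ z≈ lt

  ≤ᴮ-reflexive : ∀ {x} → x ≤ᴮ x
  ≤ᴮ-reflexive = ≤ᴮ-refl ≈-refl

  ≤ᴮ∧ℓ≥⇒≈ : ∀ {x y} → x ≤ᴮ y → ℓ y ≤ ℓ x → x ≈ y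
  ≤ᴮ∧ℓ≥⇒≈ x≤y ℓ≥ with ≤ᴮ⇒≈⊎ℓ< x≤y
  ... | inj₁ x≈y = x≈y
  ... | inj₂ ℓ<  = contradiction ℓ< (ℕ.≤⇒≯ ℓ≥)

  ≤ᴮ-antisym : ∀ {x y} → x ≤ᴮ y → y ≤ᴮ x → x ≈ y
  ≤ᴮ-antisym x≤y y≤x = ≤ᴮ∧ℓ≥⇒≈ x≤y (≤ᴮ⇒ℓ≤ y≤x)

  conjugate-reflection : ∀ {t x} g → t ∈ Reflection → x ≈ g ∙ t ∙ g ⁻¹ → x ∈ Reflection
  conjugate-reflection {t} {x} g (v , s , t≈) x≈ = g ∙ v , s , (begin
    x                                  ≈⟨ x≈ ⟩
    g ∙ t ∙ g ⁻¹                       ≈⟨ ∙-congʳ (∙-congˡ t≈) ⟩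
    g ∙ (v ∙ gen s ∙ v ⁻¹) ∙ g ⁻¹      ≈⟨ solve 3 (λ g v s → g ⊕ (v ⊕ s ⊕ ⊖ v) ⊕ ⊖ g ⊜
                                            g ⊕ v ⊕ s ⊕ ⊖ (g ⊕ v)) ≈-refl g v (gen s) ⟩
    g ∙ v ∙ gen s ∙ (g ∙ v) ⁻¹         ∎)

  gen-reflection : ∀ s → gen s ∈ Reflection
  gen-reflection s = ε , s , solve 1 (λ s → s ⊜ 𝟙 ⊕ s ⊕ ⊖ 𝟙) ≈-refl (gen s)

  infix 4 _↗_
  -- `≤ᴮ-step` multiplies by a reflection on the right, whereas `η` measures multiplication on the
  -- left; conjugating by the smaller element passes between the two.
  _↗_ : Carrier → Carrier → Set (c ⊔ e ⊔ s)
  y ↗ z = ∃ λ t → t ∈ Reflection × z ≈ t ∙ y × ℓ y < ℓ z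

  ↗⇒≤ᴮ : ∀ {y z} → y ↗ z → y ≤ᴮ z
  ↗⇒≤ᴮ {y} {z} (t , t∈ , z≈ , lt) = ≤ᴮ-step ≤ᴮ-reflexive
    (conjugate-reflection (y ⁻¹) t∈ ≈-refl)
    (≈-trans z≈ (solve 2 (λ y t → t ⊕ y ⊜ y ⊕ (⊖ y ⊕ t ⊕ ⊖ (⊖ y))) ≈-refl y t)) lt

  step⇒↗ : ∀ {y z t} → t ∈ Reflection → z ≈ y ∙ t → ℓ y < ℓ z → y ↗ z
  step⇒↗ {y} {z} {t} t∈ z≈ lt = y ∙ t ∙ y ⁻¹ , conjugate-reflection y t∈ ≈-refl ,
    ≈-trans z≈ (solve 2 (λ y t → y ⊕ t ⊜ y ⊕ t ⊕ ⊖ y ⊕ y) ≈-refl y t) , lt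

  gen-↗ : ∀ s {w} → ℓ w < ℓ (gen s ∙ w) → w ↗ gen s ∙ w
  gen-↗ s lt = gen s , gen-reflection s , ≈-refl , lt

  gen-↗′ : ∀ s {w} → ℓ (gen s ∙ w) < ℓ w → gen s ∙ w ↗ w
  gen-↗′ s {w} lt = gen s , gen-reflection s , ≈-sym (gen-cancelˡ s w) , lt

  ℓ-gen-∙ : ∀ s w → ℓ w < ℓ (gen s ∙ w) ⊎ ℓ (gen s ∙ w) < ℓ w
  ℓ-gen-∙ s = reflection-ℓ (gen-reflection s)

  -- For t ≠ s the cocycle gives η (s y) (s t s) = η y t.
  ↗-gen : ∀ s {y z} → y ↗ z → z ≈ gen s ∙ y ⊎ gen s ∙ y ↗ gen s ∙ z
  ↗-gen s {y} {z} (t , t∈ , z≈ , lt) with em {P = t ≈ gen s}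
  ... | yes t≈s = inj₁ (≈-trans z≈ (∙-congʳ t≈s))
  ... | no  t≉s = inj₂ (t′ , t′∈ , sz≈ , subst (ℓ (gen s ∙ y) <_) (ℓ-cong (≈-sym sz≈))
      (η-false⇒ℓ< t′∈ (gen s ∙ y) (≡.trans (η-gen-∙ s y t′) (cong₂ _xor_
        (δ-no λ t′≈s → t≉s (∙-cancelʳ (gen s ⁻¹) _ _ (∙-cancelˡ (gen s) _ _ (≈-trans (≈-sym (assoc _ _ _))
          (≈-trans t′≈s (solve 1 (λ s → s ⊜ s ⊕ (s ⊕ ⊖ s)) ≈-refl (gen s)))))))
        (≡.trans (η-cong ≈-refl (solve 2 (λ s t → ⊖ s ⊕ (s ⊕ t ⊕ ⊖ s) ⊕ s ⊜ t) ≈-refl (gen s) t))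
                 (ℓ>⇒η t y (subst (ℓ y <_) (ℓ-cong z≈) lt)))))))
    where
    t′ : Carrier
    t′ = gen s ∙ t ∙ gen s ⁻¹
    t′∈ : t′ ∈ Reflection
    t′∈ = conjugate-reflection (gen s) t∈ ≈-refl
    sz≈ : gen s ∙ z ≈ t′ ∙ (gen s ∙ y)
    sz≈ = ≈-trans (∙-congˡ z≈) (solve 3 (λ s t y → s ⊕ (t ⊕ y) ⊜ s ⊕ t ⊕ ⊖ s ⊕ (s ⊕ y)) ≈-refl (gen s) t y)

  act-up : ∀ s {w} → ℓ w < ℓ (gen s ∙ w) → act s w ≡ gen s ∙ w
  act-up s {w} lt with em {P = w <ᴮ gen s ∙ w}
  ... | yes _  = ≡.refl
  ... | no w≮ = contradiction (↗⇒≤ᴮ (gen-↗ s lt) , λ w≈ → ℕ.<⇒≢ lt (ℓ-cong w≈)) w≮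

  act-down : ∀ s {w} → ℓ (gen s ∙ w) < ℓ w → act s w ≡ w
  act-down s {w} lt with em {P = w <ᴮ gen s ∙ w}
  ... | yes (w≤ , _) = contradiction (≤ᴮ⇒ℓ≤ w≤) (ℕ.<⇒≱ lt)
  ... | no _         = ≡.refl

  ≤ᴮ-act : ∀ s w → w ≤ᴮ act s w
  ≤ᴮ-act s w with ℓ-gen-∙ s w
  ... | inj₁ lt rewrite act-up s lt   = ↗⇒≤ᴮ (gen-↗ s lt)
  ... | inj₂ gt rewrite act-down s gt = ≤ᴮ-reflexive

  gen-≤ᴮ-act : ∀ s w → gen s ∙ w ≤ᴮ act s w
  gen-≤ᴮ-act s w with ℓ-gen-∙ s w
  ... | inj₁ lt rewrite act-up s lt   = ≤ᴮ-reflexive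
  ... | inj₂ gt rewrite act-down s gt = ↗⇒≤ᴮ (gen-↗′ s gt)

  -- It is enough that `act s` respects the last step w′ ↗ w of the chain. By `↗-gen` either w is s
  -- w′ itself or s w′ ↗ s w, and in both cases s w′ lies below s * w.
  gen-mono-act : ∀ s {y w} → y ≤ᴮ w → gen s ∙ y ≤ᴮ act s w
  gen-mono-act s {y} {w} (≤ᴮ-refl y≈w) = ≤ᴮ-respˡ (∙-congˡ (≈-sym y≈w)) (gen-≤ᴮ-act s w)
  gen-mono-act s {y} {w} (≤ᴮ-step {w′} y≤w′ t∈ w≈ lt) =
    ≤ᴮ-trans (gen-mono-act s y≤w′) (act-≤ (ℓ-gen-∙ s w′))
    where
    w′↗w : w′ ↗ w
    w′↗w = step⇒↗ t∈ w≈ lt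
    sw′≤ : gen s ∙ w′ ≤ᴮ act s w
    sw′≤ with ↗-gen s w′↗w
    ... | inj₁ w≈sw′ = ≤ᴮ-respˡ w≈sw′ (≤ᴮ-act s w)
    ... | inj₂ sw′↗sw = ≤ᴮ-trans (↗⇒≤ᴮ sw′↗sw) (gen-≤ᴮ-act s w)
    act-≤ : ℓ w′ < ℓ (gen s ∙ w′) ⊎ ℓ (gen s ∙ w′) < ℓ w′ → act s w′ ≤ᴮ act s w
    act-≤ (inj₁ lt′) rewrite act-up s lt′ = sw′≤
    act-≤ (inj₂ gt)  rewrite act-down s gt = ≤ᴮ-trans (↗⇒≤ᴮ w′↗w) (≤ᴮ-act s w)

  ≤ᴮ-both : S → Carrier → Carrier → Set (c ⊔ e ⊔ s)
  ≤ᴮ-both s x v = x ≤ᴮ v × x ≤ᴮ gen s ∙ v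

  ≤ᴮ-both-↗ : ∀ s {x y z} → y ↗ z → ≤ᴮ-both s x y → ≤ᴮ-both s x z
  ≤ᴮ-both-↗ s {x} {y} {z} y↗z (x≤y , x≤sy) with ↗-gen s y↗z
  ... | inj₁ z≈sy  = ≤ᴮ-respʳ (≈-sym z≈sy) x≤sy ,
    ≤ᴮ-respʳ (≈-sym (≈-trans (∙-congˡ z≈sy) (gen-cancelˡ s y))) x≤y
  ... | inj₂ sy↗sz = ≤ᴮ-trans x≤y (↗⇒≤ᴮ y↗z) , ≤ᴮ-trans x≤sy (↗⇒≤ᴮ sy↗sz)

  -- The alternative is decided at the bottom of the chain, by which of y and s y is shorter, and is
  -- then carried up by `≤ᴮ-both-↗`. Bounding by v and s v at once avoids distinguishing the
  -- descents of v at every step.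
  lifting : ∀ s {y v} → y ≤ᴮ v → ≤ᴮ-both s y v ⊎ ≤ᴮ-both s (gen s ∙ y) v
  lifting s {y} {v} (≤ᴮ-refl y≈v) with ℓ-gen-∙ s v
  ... | inj₁ lt = inj₁ (≤ᴮ-refl y≈v , ≤ᴮ-respˡ (≈-sym y≈v) (↗⇒≤ᴮ (gen-↗ s lt)))
  ... | inj₂ gt = inj₂ (≤ᴮ-respˡ (∙-congˡ (≈-sym y≈v)) (↗⇒≤ᴮ (gen-↗′ s gt)) , ≤ᴮ-refl (∙-congˡ y≈v))
  lifting s (≤ᴮ-step y≤v′ t∈ v≈ lt) with lifting s y≤v′
  ... | inj₁ both = inj₁ (≤ᴮ-both-↗ s (step⇒↗ t∈ v≈ lt) both)
  ... | inj₂ both = inj₂ (≤ᴮ-both-↗ s (step⇒↗ t∈ v≈ lt) both)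

  ≤ᴮ-act⁻ : ∀ s {y w} → y ≤ᴮ act s w → y ≤ᴮ w ⊎ gen s ∙ y ≤ᴮ w
  ≤ᴮ-act⁻ s {y} {w} y≤ with ℓ-gen-∙ s w
  ... | inj₂ gt rewrite act-down s gt = inj₁ y≤
  ... | inj₁ lt rewrite act-up s lt with lifting s y≤
  ...   | inj₁ (_ , y≤ssw)  = inj₁ (≤ᴮ-respʳ (gen-cancelˡ s w) y≤ssw)
  ...   | inj₂ (_ , sy≤ssw) = inj₂ (≤ᴮ-respʳ (gen-cancelˡ s w) sy≤ssw)

  ≤ᴮ-act⁺ : ∀ s {y w} → y ≤ᴮ w ⊎ gen s ∙ y ≤ᴮ w → y ≤ᴮ act s w
  ≤ᴮ-act⁺ s {w = w} (inj₁ y≤w)  = ≤ᴮ-trans y≤w (≤ᴮ-act s w)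
  ≤ᴮ-act⁺ s {y}     (inj₂ sy≤w) = ≤ᴮ-respˡ (gen-cancelˡ s y) (gen-mono-act s sy≤w)

  -- Inversion turns right multiplication by a reflection into left multiplication by the same one.
  -- It serves to deduce right-handed statements from left-handed ones.
  ≤ᴮ-⁻¹ : ∀ {y w} → y ≤ᴮ w → y ⁻¹ ≤ᴮ w ⁻¹
  ≤ᴮ-⁻¹ (≤ᴮ-refl y≈w) = ≤ᴮ-refl (⁻¹-cong y≈w)
  ≤ᴮ-⁻¹ {y} {w} (≤ᴮ-step {w′} {t = t} y≤ t∈ w≈ lt) = ≤ᴮ-trans (≤ᴮ-⁻¹ y≤) (↗⇒≤ᴮ
    (t , t∈
       , ≈-trans (⁻¹-cong w≈) (≈-trans (⁻¹-anti-homo-∙ _ _) (∙-congʳ (reflection-⁻¹ t∈)))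
       , subst₂< (ℓ-⁻¹ w′) (ℓ-⁻¹ w) lt))
    where
    subst₂< : ∀ {a b a′ b′} → a′ ≡ a → b′ ≡ b → a < b → a′ < b′
    subst₂< ≡.refl ≡.refl lt = lt

  ≤ᴮ-⁻¹⁻ : ∀ {y w} → y ⁻¹ ≤ᴮ w ⁻¹ → y ≤ᴮ w
  ≤ᴮ-⁻¹⁻ y≤w = ≤ᴮ-respˡ (⁻¹-involutive _) (≤ᴮ-respʳ (⁻¹-involutive _) (≤ᴮ-⁻¹ y≤w))

  -- The *-product

  ≤ᴮ-ε : ∀ {y} → y ≤ᴮ ε → y ≈ ε
  ≤ᴮ-ε y≤ε = ℓ≡0⇒ε _ (ℕ.n≤0⇒n≡0 (subst (ℓ _ ≤_) ℓ-ε (≤ᴮ⇒ℓ≤ y≤ε)))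

  infixl 7 _·↓_
  _·↓_ : Carrier → Carrier → Pred Carrier (c ⊔ e ⊔ s)
  (x ·↓ w) y = ∃₂ λ a b → a ≤ᴮ x × b ≤ᴮ w × y ≈ a ∙ b

  -- The induction runs over all words, with the *-product `foldr act ε u` of the letters in place
  -- of `⟦ u ⟧`; on reduced words the two agree by `foldr-act-reduced`.
  ≤ᴮ-foldr⁻ : ∀ u {w y} → y ≤ᴮ foldr act w u → y ∈ foldr act ε u ·↓ w
  ≤ᴮ-foldr⁻ []      {y = y} y≤ = ε , y , ≤ᴮ-reflexive , y≤ , ≈-sym (identityˡ y)
  ≤ᴮ-foldr⁻ (s ∷ u) {y = y} y≤ with ≤ᴮ-act⁻ s y≤
  ... | inj₁ y≤′ with a , b , a≤ , b≤ , y≈ ← ≤ᴮ-foldr⁻ u y≤′ = a , b , ≤ᴮ-act⁺ s (inj₁ a≤) , b≤ , y≈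
  ... | inj₂ sy≤ with a , b , a≤ , b≤ , sy≈ ← ≤ᴮ-foldr⁻ u sy≤ =
    gen s ∙ a , b , ≤ᴮ-act⁺ s (inj₂ (≤ᴮ-respˡ (≈-sym (gen-cancelˡ s a)) a≤)) , b≤ ,
    ≈-trans (≈-sym (gen-cancelˡ s y)) (≈-trans (∙-congˡ sy≈) (≈-sym (assoc _ _ _)))

  ≤ᴮ-foldr⁺ : ∀ u {w y} → y ∈ foldr act ε u ·↓ w → y ≤ᴮ foldr act w u
  ≤ᴮ-foldr⁺ [] (a , b , a≤ , b≤ , y≈) = ≤ᴮ-respˡ (≈-sym (≈-trans y≈ (≈-trans (∙-congʳ (≤ᴮ-ε a≤)) (identityˡ b)))) b≤
  ≤ᴮ-foldr⁺ (s ∷ u) (a , b , a≤ , b≤ , y≈) with ≤ᴮ-act⁻ s a≤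
  ... | inj₁ a≤′ = ≤ᴮ-act⁺ s (inj₁ (≤ᴮ-foldr⁺ u (a , b , a≤′ , b≤ , y≈)))
  ... | inj₂ sa≤ = ≤ᴮ-act⁺ s (inj₂ (≤ᴮ-foldr⁺ u
    (gen s ∙ a , b , sa≤ , b≤ , ≈-trans (∙-congˡ y≈) (≈-sym (assoc _ _ _)))))

  foldr-act-reduced : ∀ u → length u ≤ ℓ ⟦ u ⟧ → foldr act ε u ≈ ⟦ u ⟧
  foldr-act-reduced []      _  = ≈-refl
  foldr-act-reduced (s ∷ u) red = ≈-trans (reflexive (act-up s ℓ-up)) (∙-congˡ ih)
    where
    red′ : length u ≤ ℓ ⟦ u ⟧
    red′ = ℕ.≤-pred (ℕ.≤-trans red (ℕ.≤-trans (ℓ-∙ (gen s) ⟦ u ⟧) (ℕ.+-monoˡ-≤ _ (ℓ-gen s))))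
    ih : foldr act ε u ≈ ⟦ u ⟧
    ih = foldr-act-reduced u red′
    ℓ-up : ℓ (foldr act ε u) < ℓ (gen s ∙ foldr act ε u)
    ℓ-up = ℕ.≤-trans (s≤s (ℕ.≤-trans (ℓ-mono ih) (ℓ-word u ≈-refl))) (ℕ.≤-trans red (ℓ-mono (∙-congˡ (≈-sym ih))))

  foldr-act-reducedWord : ∀ x → foldr act ε (reducedWord x) ≈ x
  foldr-act-reducedWord x = ≈-trans
    (foldr-act-reduced (reducedWord x) (ℓ-mono (≈-sym (⟦reducedWord⟧ x)))) (⟦reducedWord⟧ x)

  ⋆-lower⁻ : ∀ {x w y} → y ≤ᴮ x ⋆ w → y ∈ x ·↓ w
  ⋆-lower⁻ {x} y≤ with a , b , a≤ , b≤ , y≈ ← ≤ᴮ-foldr⁻ (reducedWord x) y≤ =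
    a , b , ≤ᴮ-respʳ (foldr-act-reducedWord x) a≤ , b≤ , y≈

  ⋆-lower⁺ : ∀ {x w y} → y ∈ x ·↓ w → y ≤ᴮ x ⋆ w
  ⋆-lower⁺ {x} (a , b , a≤ , b≤ , y≈) = ≤ᴮ-foldr⁺ (reducedWord x)
    (a , b , ≤ᴮ-respʳ (≈-sym (foldr-act-reducedWord x)) a≤ , b≤ , y≈)

  ε≤ᴮ : ∀ w → ε ≤ᴮ w
  ε≤ᴮ w = ≤ᴮ-respʳ (foldr-act-reducedWord w) (below (reducedWord w))
    where
    below : ∀ u → ε ≤ᴮ foldr act ε u
    below []      = ≤ᴮ-reflexive
    below (s ∷ u) = ≤ᴮ-act⁺ s (inj₁ (below u))

  -- Parabolic subgroups

  ⟨⟩-closedˡ : ∀ {a} {P : Pred Carrier a} {I} → (∀ {x y} → x ≈ y → P x → P y) →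
    (∀ {i x} → i ∈ I → P x → P (gen i ∙ x)) → ∀ {g x} → g ∈ ⟨ I ⟩ → P x → P (g ∙ x)
  ⟨⟩-closedˡ {P = P} {I} resp closed g∈ = proj₁ (go g∈)
    where
    -- An element and its inverse are treated together because `⟨⁻¹⟩` exchanges them.
    go : ∀ {g} → g ∈ ⟨ I ⟩ → (∀ {x} → P x → P (g ∙ x)) × (∀ {x} → P x → P (g ⁻¹ ∙ x))
    go (⟨gen⟩ {i} i∈)    = closed i∈ , λ Px → resp (∙-congʳ (≈-sym (gen⁻¹ i))) (closed i∈ Px)
    go ⟨ε⟩               = resp (≈-sym (identityˡ _))
                         , resp (solve 1 (λ x → x ⊜ ⊖ 𝟙 ⊕ x) ≈-refl _)
    go (⟨∙⟩ g∈ h∈)       = (λ Px → resp (≈-sym (assoc _ _ _)) (proj₁ (go g∈) (proj₁ (go h∈) Px)))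
                         , (λ Px → resp (solve 3 (λ g h x → ⊖ h ⊕ (⊖ g ⊕ x) ⊜ ⊖ (g ⊕ h) ⊕ x) ≈-refl _ _ _)
                                        (proj₂ (go h∈) (proj₂ (go g∈) Px)))
    go (⟨⁻¹⟩ g∈)         = proj₂ (go g∈) , λ Px → resp (∙-congʳ (≈-sym (⁻¹-involutive _))) (proj₁ (go g∈) Px)
    go (⟨≈⟩ g≈h g∈)      = (λ Px → resp (∙-congʳ g≈h) (proj₁ (go g∈) Px))
                         , (λ Px → resp (∙-congʳ (⁻¹-cong g≈h)) (proj₂ (go g∈) Px))

  ⟨⟩-mono : ∀ {I J} → I ⊆ J → ⟨ I ⟩ ⊆ ⟨ J ⟩
  ⟨⟩-mono I⊆J (⟨gen⟩ i∈)    = ⟨gen⟩ (I⊆J i∈)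
  ⟨⟩-mono I⊆J ⟨ε⟩           = ⟨ε⟩
  ⟨⟩-mono I⊆J (⟨∙⟩ x∈ y∈)   = ⟨∙⟩ (⟨⟩-mono I⊆J x∈) (⟨⟩-mono I⊆J y∈)
  ⟨⟩-mono I⊆J (⟨⁻¹⟩ x∈)     = ⟨⁻¹⟩ (⟨⟩-mono I⊆J x∈)
  ⟨⟩-mono I⊆J (⟨≈⟩ x≈y x∈)  = ⟨≈⟩ x≈y (⟨⟩-mono I⊆J x∈)

  private
    lower-act : ∀ {I i z} → i ∈ I → (_≤ᴮ z) ⊆ ⟨ I ⟩ → (_≤ᴮ act i z) ⊆ ⟨ I ⟩
    lower-act {i = i} i∈ z↓⊆ y≤ with ≤ᴮ-act⁻ i y≤
    ... | inj₁ y≤z  = z↓⊆ y≤z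
    ... | inj₂ iy≤z = ⟨≈⟩ (gen-cancelˡ i _) (⟨∙⟩ (⟨gen⟩ i∈) (z↓⊆ iy≤z))

  -- The induction carries an upper bound z of x whose whole lower set lies in W_I. Multiplying x by
  -- i replaces z by i * z, and D(i * z) = D(z) ∪ i D(z) stays in W_I.
  ⟨⟩-lower : ∀ {I x} → x ∈ ⟨ I ⟩ → (_≤ᴮ x) ⊆ ⟨ I ⟩
  ⟨⟩-lower {I} {x} x∈ y≤x
    with z , x≤z , z↓⊆ ← ⟨⟩-closedˡ {P = λ x → ∃ λ z → x ≤ᴮ z × (_≤ᴮ z) ⊆ ⟨ I ⟩}
           (λ x≈y (z , x≤z , z↓⊆) → z , ≤ᴮ-respˡ x≈y x≤z , z↓⊆)
           (λ {i} i∈ (z , x≤z , z↓⊆) → act i z , gen-mono-act i x≤z , lower-act i∈ z↓⊆)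
           x∈ (ε , ≤ᴮ-reflexive , λ y≤ε → ⟨≈⟩ (≈-sym (≤ᴮ-ε y≤ε)) ⟨ε⟩)
    = z↓⊆ (≤ᴮ-trans y≤x (≤ᴮ-respˡ (identityʳ x) x≤z))

  LeftMax RightMax LeftMin RightMin : Pred S 0ℓ → Pred Carrier s
  LeftMax  I w = ∀ {i} → i ∈ I → ℓ (gen i ∙ w) < ℓ w
  RightMax I w = ∀ {i} → i ∈ I → ℓ (w ∙ gen i) < ℓ w
  LeftMin  I w = ∀ {i} → i ∈ I → ℓ w < ℓ (gen i ∙ w)
  RightMin I w = ∀ {i} → i ∈ I → ℓ w < ℓ (w ∙ gen i)

  ℓ-gen-⁻¹ : ∀ i w → ℓ (gen i ∙ w ⁻¹) ≡ ℓ (w ∙ gen i)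
  ℓ-gen-⁻¹ i w = ≡.trans (ℓ-cong (≈-trans (∙-congʳ (≈-sym (gen⁻¹ i))) (≈-sym (⁻¹-anti-homo-∙ _ _)))) (ℓ-⁻¹ _)

  RightMax⇒LeftMax-⁻¹ : ∀ {I w} → RightMax I w → LeftMax I (w ⁻¹)
  RightMax⇒LeftMax-⁻¹ {w = w} right {i} i∈ rewrite ℓ-gen-⁻¹ i w | ℓ-⁻¹ w = right i∈

  RightMin⇒LeftMin-⁻¹ : ∀ {I w} → RightMin I w → LeftMin I (w ⁻¹)
  RightMin⇒LeftMin-⁻¹ {w = w} right {i} i∈ rewrite ℓ-gen-⁻¹ i w | ℓ-⁻¹ w = right i∈

  ℓ-∙-gen : ∀ s w → ℓ w < ℓ (w ∙ gen s) ⊎ ℓ (w ∙ gen s) < ℓ w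
  ℓ-∙-gen s w with ℓ-gen-∙ s (w ⁻¹)
  ... | inj₁ lt rewrite ℓ-gen-⁻¹ s w | ℓ-⁻¹ w = inj₁ lt
  ... | inj₂ gt rewrite ℓ-gen-⁻¹ s w | ℓ-⁻¹ w = inj₂ gt

  -- Here i * w = w for every i ∈ I, so `gen-mono-act` never leaves D(w).
  LeftMax-∙ : ∀ {I w} → LeftMax I w → ∀ {g y} → g ∈ ⟨ I ⟩ → y ≤ᴮ w → g ∙ y ≤ᴮ w
  LeftMax-∙ {w = w} left = ⟨⟩-closedˡ ≤ᴮ-respˡ
    λ {i} i∈ y≤w → subst (gen i ∙ _ ≤ᴮ_) (act-down i (left i∈)) (gen-mono-act i y≤w)

  RightMax-∙ : ∀ {I w} → RightMax I w → ∀ {g y} → g ∈ ⟨ I ⟩ → y ≤ᴮ w → y ∙ g ≤ᴮ w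
  RightMax-∙ {w = w} right g∈ y≤w = ≤ᴮ-⁻¹⁻ (≤ᴮ-respˡ (≈-sym (⁻¹-anti-homo-∙ _ _))
    (LeftMax-∙ (RightMax⇒LeftMax-⁻¹ {w = w} right) (⟨⁻¹⟩ g∈) (≤ᴮ-⁻¹ y≤w)))

  LeftMin-∙ : ∀ {I w} → LeftMin I w → ∀ {g y} → g ∈ ⟨ I ⟩ → w ≤ᴮ y → w ≤ᴮ g ∙ y
  LeftMin-∙ {I} {w} left = ⟨⟩-closedˡ (λ x≈y → ≤ᴮ-respʳ x≈y) step
    where
    step : ∀ {i x} → i ∈ I → w ≤ᴮ x → w ≤ᴮ gen i ∙ x
    step {i} i∈ w≤x with lifting i w≤x
    ... | inj₁ (_ , w≤ix)  = w≤ix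
    ... | inj₂ (_ , iw≤ix) = ≤ᴮ-trans (↗⇒≤ᴮ (gen-↗ i (left i∈))) iw≤ix

  RightMin-∙ : ∀ {I w} → RightMin I w → ∀ {g y} → g ∈ ⟨ I ⟩ → w ≤ᴮ y → w ≤ᴮ y ∙ g
  RightMin-∙ {w = w} right g∈ w≤y = ≤ᴮ-⁻¹⁻ (≤ᴮ-respʳ (≈-sym (⁻¹-anti-homo-∙ _ _))
    (LeftMin-∙ (RightMin⇒LeftMin-⁻¹ {w = w} right) (⟨⁻¹⟩ g∈) (≤ᴮ-⁻¹ w≤y)))

  module _ (I : Finitary) where
    longest∈ : longest I ∈ ⟨ set I ⟩
    longest∈ = proj₁ (proj₂ (ℓ-max-exists (finite I) ⟨ε⟩))

    ℓ≤longest : ∀ {x} → x ∈ ⟨ set I ⟩ → ℓ x ≤ ℓ (longest I)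
    ℓ≤longest = proj₂ (proj₂ (ℓ-max-exists (finite I) ⟨ε⟩)) _

    longest-LeftMax : LeftMax (set I) (longest I)
    longest-LeftMax {i} i∈ with ℓ-gen-∙ i (longest I)
    ... | inj₁ lt = contradiction lt (ℕ.≤⇒≯ (ℓ≤longest (⟨∙⟩ (⟨gen⟩ i∈) longest∈)))
    ... | inj₂ gt = gt

    longest-RightMax : RightMax (set I) (longest I)
    longest-RightMax {i} i∈ with ℓ-∙-gen i (longest I)
    ... | inj₁ lt = contradiction lt (ℕ.≤⇒≯ (ℓ≤longest (⟨∙⟩ longest∈ (⟨gen⟩ i∈))))
    ... | inj₂ gt = gt

    ∈⇒≤ᴮlongest : ∀ {y} → y ∈ ⟨ set I ⟩ → y ≤ᴮ longest I
    ∈⇒≤ᴮlongest y∈ = ≤ᴮ-respˡ (identityʳ _) (LeftMax-∙ longest-LeftMax y∈ (ε≤ᴮ _))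

    ≤ᴮlongest⇒∈ : ∀ {y} → y ≤ᴮ longest I → y ∈ ⟨ set I ⟩
    ≤ᴮlongest⇒∈ = ⟨⟩-lower longest∈

    LeftMax⇒longest : ∀ {w} → w ∈ ⟨ set I ⟩ → LeftMax (set I) w → w ≈ longest I
    LeftMax⇒longest {w} w∈ left = ≈-sym (≤ᴮ∧ℓ≥⇒≈
      (≤ᴮ-respˡ (identityʳ _) (LeftMax-∙ {w = w} left longest∈ (ε≤ᴮ w))) (ℓ≤longest w∈))

    RightMax⇒longest : ∀ {w} → w ∈ ⟨ set I ⟩ → RightMax (set I) w → w ≈ longest I
    RightMax⇒longest {w} w∈ right = ≈-sym (≤ᴮ∧ℓ≥⇒≈
      (≤ᴮ-respˡ (identityˡ _) (RightMax-∙ {w = w} right longest∈ (ε≤ᴮ w))) (ℓ≤longest w∈))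

  -- Double cosets

  module _ {I J : Finitary} (p : Coset I J) where
    elements-translate : ∀ {x g h} → g ∈ ⟨ set I ⟩ → h ∈ ⟨ set J ⟩ → x ∈ elements p → g ∙ x ∙ h ∈ elements p
    elements-translate g∈ h∈ (a , b , a∈ , b∈ , x≈) = _ , _ , ⟨∙⟩ g∈ a∈ , ⟨∙⟩ b∈ h∈ ,
      ≈-trans (∙-congʳ (∙-congˡ x≈))
        (solve 5 (λ g a r b h → g ⊕ (a ⊕ r ⊕ b) ⊕ h ⊜ g ⊕ a ⊕ r ⊕ (b ⊕ h)) ≈-refl _ _ _ _ _)

    elements-gen-∙ : ∀ {x i} → i ∈ set I → x ∈ elements p → gen i ∙ x ∈ elements p
    elements-gen-∙ i∈ x∈ with a , b , a∈ , b∈ , eq ← elements-translate (⟨gen⟩ i∈) ⟨ε⟩ x∈ =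
      a , b , a∈ , b∈ , ≈-trans (≈-sym (identityʳ _)) eq

    elements-∙-gen : ∀ {x j} → j ∈ set J → x ∈ elements p → x ∙ gen j ∈ elements p
    elements-∙-gen j∈ x∈ with a , b , a∈ , b∈ , eq ← elements-translate ⟨ε⟩ (⟨gen⟩ j∈) x∈ =
      a , b , a∈ , b∈ , ≈-trans (∙-congʳ (≈-sym (identityˡ _))) eq

    elements-related : ∀ {x y} → x ∈ elements p → y ∈ elements p →
      ∃₂ λ g h → g ∈ ⟨ set I ⟩ × h ∈ ⟨ set J ⟩ × y ≈ g ∙ x ∙ h
    elements-related {x} {y} (a , b , a∈ , b∈ , x≈) (a′ , b′ , a′∈ , b′∈ , y≈) =
      a′ ∙ a ⁻¹ , b ⁻¹ ∙ b′ , ⟨∙⟩ a′∈ (⟨⁻¹⟩ a∈) , ⟨∙⟩ (⟨⁻¹⟩ b∈) b′∈ , (begin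
        y                                                   ≈⟨ y≈ ⟩
        a′ ∙ rep p ∙ b′                                     ≈⟨ solve 5 (λ a b a′ b′ r → a′ ⊕ r ⊕ b′ ⊜
          a′ ⊕ ⊖ a ⊕ (a ⊕ r ⊕ b) ⊕ (⊖ b ⊕ b′)) ≈-refl _ _ _ _ _ ⟩
        a′ ∙ a ⁻¹ ∙ (a ∙ rep p ∙ b) ∙ (b ⁻¹ ∙ b′)           ≈⟨ ∙-congʳ (∙-congˡ x≈) ⟨
        a′ ∙ a ⁻¹ ∙ x ∙ (b ⁻¹ ∙ b′)                         ∎)

    max∈ : max p ∈ elements p
    max∈ = proj₁ (proj₂ (maximal-exists p))

    min∈ : min p ∈ elements p
    min∈ = proj₁ (proj₂ (minimal-exists p))

    max-LeftMax : LeftMax (set I) (max p)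
    max-LeftMax {i} i∈ with ℓ-gen-∙ i (max p)
    ... | inj₂ gt = gt
    ... | inj₁ lt = contradiction
      (ℓ-cong (proj₂ (proj₂ (maximal-exists p)) _ (elements-gen-∙ i∈ max∈) (↗⇒≤ᴮ (gen-↗ i lt)))) (ℕ.<⇒≢ lt)

    private
      ∙-gen-≤ᴮ : ∀ {j w} → ℓ w < ℓ (w ∙ gen j) → w ≤ᴮ w ∙ gen j
      ∙-gen-≤ᴮ {j} = ≤ᴮ-step ≤ᴮ-reflexive (gen-reflection j) ≈-refl

    max-RightMax : RightMax (set J) (max p)
    max-RightMax {j} j∈ with ℓ-∙-gen j (max p)
    ... | inj₂ gt = gt
    ... | inj₁ lt = contradiction
      (ℓ-cong (proj₂ (proj₂ (maximal-exists p)) _ (elements-∙-gen j∈ max∈) (∙-gen-≤ᴮ lt))) (ℕ.<⇒≢ lt)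

    min-LeftMin : LeftMin (set I) (min p)
    min-LeftMin {i} i∈ with ℓ-gen-∙ i (min p)
    ... | inj₁ lt = lt
    ... | inj₂ gt = contradiction
      (ℓ-cong (≈-sym (proj₂ (proj₂ (minimal-exists p)) _ (elements-gen-∙ i∈ min∈) (↗⇒≤ᴮ (gen-↗′ i gt))))) (ℕ.<⇒≢ gt)

    min-RightMin : RightMin (set J) (min p)
    min-RightMin {j} j∈ with ℓ-∙-gen j (min p)
    ... | inj₁ lt = lt
    ... | inj₂ gt = contradiction
      (ℓ-cong (≈-sym (proj₂ (proj₂ (minimal-exists p)) _ (elements-∙-gen j∈ min∈)
        (≤ᴮ-step ≤ᴮ-reflexive (gen-reflection j) (≈-sym (gen-cancelʳ j (min p))) gt)))) (ℕ.<⇒≢ gt)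

    -- The descents of w make D(w) stable under W_I on the left and W_J on the right, so D(w)
    -- contains a whole coset as soon as it meets it.
    max-absorbs : ∀ {x y} → x ∈ elements p → y ∈ elements p → ∀ {w} → LeftMax (set I) w → RightMax (set J) w →
      x ≤ᴮ w → y ≤ᴮ w
    max-absorbs x∈ y∈ {w} left right x≤w with g , h , g∈ , h∈ , y≈ ← elements-related x∈ y∈ =
      ≤ᴮ-respˡ (≈-sym y≈) (RightMax-∙ {w = w} right h∈ (LeftMax-∙ {w = w} left g∈ x≤w))

    elements≤max : ∀ {y} → y ∈ elements p → y ≤ᴮ max p
    elements≤max y∈ = max-absorbs max∈ y∈ max-LeftMax max-RightMax ≤ᴮ-reflexive

    min≤elements : ∀ {y} → y ∈ elements p → min p ≤ᴮ y
    min≤elements y∈ with g , h , g∈ , h∈ , y≈ ← elements-related min∈ y∈ =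
      ≤ᴮ-respʳ (≈-sym y≈) (RightMin-∙ {w = min p} min-RightMin h∈ (LeftMin-∙ {w = min p} min-LeftMin g∈ ≤ᴮ-reflexive))

  module _ {I J : Finitary} (p q : Coset I J) where
    min≤⇒max≤ : min p ≤ᴮ min q → max p ≤ᴮ max q
    min≤⇒max≤ min≤ = max-absorbs p (min∈ p) (max∈ p) (max-LeftMax q) (max-RightMax q)
      (≤ᴮ-trans min≤ (elements≤max q (min∈ q)))

    -- As `max q` lies in W_I (min q) W_J, it is below w_I * min q * w_J. Hence min p = a y b with a
    -- ∈ W_I, b ∈ W_J and y ≤ min q, and this y is an element of p.
    max≤⇒min≤ : max p ≤ᴮ max q → min p ≤ᴮ min q
    max≤⇒min≤ max≤
      with g , h , g∈ , h∈ , maxq≈ ← elements-related q (min∈ q) (max∈ q)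
      with ab , b , ab≤ , b≤ , minp≈ ← ⋆-lower⁻ {longest I ⋆ min q} {longest J} (≤ᴮ-trans (min≤elements p (max∈ p)) (≤ᴮ-trans max≤
             (⋆-lower⁺ (_ , _ , ⋆-lower⁺ (_ , _ , ∈⇒≤ᴮlongest I g∈ , ≤ᴮ-reflexive , ≈-refl)
                              , ∈⇒≤ᴮlongest J h∈ , maxq≈))))
      with a , y , a≤ , y≤ , ab≈ ← ⋆-lower⁻ {longest I} {min q} ab≤
      = ≤ᴮ-trans (min≤elements p y∈) y≤
      where
      y∈ : y ∈ elements p
      y∈ with a′ , b′ , a′∈ , b′∈ , eq ← elements-translate p
                (⟨⁻¹⟩ (≤ᴮlongest⇒∈ I a≤)) (⟨⁻¹⟩ (≤ᴮlongest⇒∈ J b≤)) (min∈ p) =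
        a′ , b′ , a′∈ , b′∈ , ≈-trans (≈-sym (begin
          a ⁻¹ ∙ min p ∙ b ⁻¹           ≈⟨ ∙-congʳ (∙-congˡ (≈-trans minp≈ (∙-congʳ ab≈))) ⟩
          a ⁻¹ ∙ (a ∙ y ∙ b) ∙ b ⁻¹     ≈⟨ solve 3 (λ a y b → ⊖ a ⊕ (a ⊕ y ⊕ b) ⊕ ⊖ b ⊜ y) ≈-refl a y b ⟩
          y                             ∎)) eq

  -- Paths

  ⋆-product-stableˡ : ∀ {I J} (E : Expression I J) {g y} → g ∈ ⟨ set I ⟩ →
    y ≤ᴮ ⋆-product E → g ∙ y ≤ᴮ ⋆-product E
  ⋆-product-stableˡ {I} [ _ ] = LeftMax-∙ (longest-LeftMax I)
  ⋆-product-stableˡ (E ▷⁺ _) g∈ y≤ with a , b , a≤ , b≤ , y≈ ← ⋆-lower⁻ {⋆-product E} y≤ =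
    ⋆-lower⁺ (_ , b , ⋆-product-stableˡ E g∈ a≤ , b≤ , ≈-trans (∙-congˡ y≈) (≈-sym (assoc _ _ _)))
  ⋆-product-stableˡ (E ▷⁻ _) g∈ y≤ with a , b , a≤ , b≤ , y≈ ← ⋆-lower⁻ {⋆-product E} y≤ =
    ⋆-lower⁺ (_ , b , ⋆-product-stableˡ E g∈ a≤ , b≤ , ≈-trans (∙-congˡ y≈) (≈-sym (assoc _ _ _)))

  ⋆-longest-stableʳ : ∀ {x J g y} → g ∈ ⟨ set J ⟩ → y ≤ᴮ x ⋆ longest J → y ∙ g ≤ᴮ x ⋆ longest J
  ⋆-longest-stableʳ {x} {J} g∈ y≤ with a , b , a≤ , b≤ , y≈ ← ⋆-lower⁻ {x} y≤ =
    ⋆-lower⁺ (a , _ , a≤ , RightMax-∙ (longest-RightMax J) g∈ b≤ , ≈-trans (∙-congʳ y≈) (assoc _ _ _))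

  ⋆-product-stableʳ : ∀ {I J} (E : Expression I J) {g y} → g ∈ ⟨ set J ⟩ →
    y ≤ᴮ ⋆-product E → y ∙ g ≤ᴮ ⋆-product E
  ⋆-product-stableʳ {I} [ I≐J ]  g∈ = RightMax-∙ (longest-RightMax I) (⟨⟩-mono (proj₂ I≐J) g∈)
  ⋆-product-stableʳ     (E ▷⁺ _) g∈ = ⋆-longest-stableʳ {⋆-product E} g∈
  ⋆-product-stableʳ     (E ▷⁻ _) g∈ = ⋆-longest-stableʳ {⋆-product E} g∈

  ⋖⇒⊆ : ∀ {K L} → K ⋖ L → set K ⊆ set L
  ⋖⇒⊆ (_ , _ , _ , ∪⊆) k∈ = ∪⊆ (inj₁ k∈)

  -- Arbitrary representatives are allowed because, by the stability lemmas, D(`⋆-product E`) is a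
  -- union of (I,J)-cosets. An upward step multiplies this set by W_J on the right; before a
  -- downward step it is already stable under W_J.
  path⇒≤ᴮ : ∀ {I J} {E : Expression I J} {p} → Path E p → rep p ≤ᴮ ⋆-product E
  path⇒≤ᴮ {I} {p = p} (start {I≐J = I≐J} (a , b , a∈ , b∈ , ε≈)) = ∈⇒≤ᴮlongest I (⟨≈⟩ (begin
      a ⁻¹ ∙ b ⁻¹                       ≈⟨ ∙-congʳ (identityʳ _) ⟨
      a ⁻¹ ∙ ε ∙ b ⁻¹                   ≈⟨ ∙-congʳ (∙-congˡ ε≈) ⟩
      a ⁻¹ ∙ (a ∙ rep p ∙ b) ∙ b ⁻¹     ≈⟨ solve 3 (λ a r b → ⊖ a ⊕ (a ⊕ r ⊕ b) ⊕ ⊖ b ⊜ r) ≈-refl _ _ _ ⟩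
      rep p                             ∎)
    (⟨∙⟩ (⟨⁻¹⟩ a∈) (⟨⁻¹⟩ (⟨⟩-mono (proj₂ I≐J) b∈))))
  path⇒≤ᴮ (up {J = J} {E = E} {p = p} {p′} path p⊆p′)
    with a , b , a∈ , b∈ , p≈ ← p⊆p′ (rep∈elements p) =
    ⋆-lower⁺ (a ⁻¹ ∙ rep p , b ⁻¹ , ⋆-product-stableˡ E (⟨⁻¹⟩ a∈) (path⇒≤ᴮ path) ,
      ∈⇒≤ᴮlongest J (⟨⁻¹⟩ b∈) , ≈-sym (begin
        a ⁻¹ ∙ rep p ∙ b ⁻¹                ≈⟨ ∙-congʳ (∙-congˡ p≈) ⟩
        a ⁻¹ ∙ (a ∙ rep p′ ∙ b) ∙ b ⁻¹     ≈⟨ solve 3 (λ a r b → ⊖ a ⊕ (a ⊕ r ⊕ b) ⊕ ⊖ b ⊜ r) ≈-refl _ _ _ ⟩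
        rep p′                             ∎))
  path⇒≤ᴮ (down {E = E} {p′ = p′} path p′⊆p)
    with a , b , a∈ , b∈ , p′≈ ← p′⊆p (rep∈elements p′) =
    ⋆-lower⁺ (rep p′ , ε ,
      ≤ᴮ-respˡ (≈-sym p′≈) (⋆-product-stableʳ E b∈ (⋆-product-stableˡ E a∈ (path⇒≤ᴮ path))) ,
      ε≤ᴮ _ , ≈-sym (identityʳ _))

  -- The path is constructed backwards from its terminus. At an upward step rep p = y b with b ∈
  -- W_J, and the coset before it is the one through y; at a downward step it is the one through
  -- `rep p` itself.
  ≤ᴮ⇒path : ∀ {I J} (E : Expression I J) (p : Coset I J) → rep p ≤ᴮ ⋆-product E → Path E p
  ≤ᴮ⇒path {I} [ _ ] p p≤ = start (rep p ⁻¹ , ε , ⟨⁻¹⟩ (≤ᴮlongest⇒∈ I p≤) , ⟨ε⟩ ,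
    solve 1 (λ r → 𝟙 ⊜ ⊖ r ⊕ r ⊕ 𝟙) ≈-refl (rep p))
  ≤ᴮ⇒path {J = J} (_▷⁺_ {K = K} E K⋖J) p p≤ with y , b , y≤ , b≤ , p≈ ← ⋆-lower⁻ {⋆-product E} p≤ =
    up (≤ᴮ⇒path E (record { rep = y }) y≤) λ {x} (a , b′ , a∈ , b′∈ , x≈) →
      a , b ⁻¹ ∙ b′ , a∈ , ⟨∙⟩ (⟨⁻¹⟩ (≤ᴮlongest⇒∈ J b≤)) (⟨⟩-mono (⋖⇒⊆ {K} {J} K⋖J) b′∈) , (begin
        x                                 ≈⟨ x≈ ⟩
        a ∙ y ∙ b′                        ≈⟨ solve 4 (λ a y b b′ → a ⊕ y ⊕ b′ ⊜ a ⊕ (y ⊕ b) ⊕ (⊖ b ⊕ b′)) ≈-refl _ _ _ _ ⟩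
        a ∙ (y ∙ b) ∙ (b ⁻¹ ∙ b′)         ≈⟨ ∙-congʳ (∙-congˡ p≈) ⟨
        a ∙ rep p ∙ (b ⁻¹ ∙ b′)           ∎)
  ≤ᴮ⇒path {J = J} (_▷⁻_ {K = K} E J⋖K) p p≤ with y , b , y≤ , b≤ , p≈ ← ⋆-lower⁻ {⋆-product E} p≤ =
    down (≤ᴮ⇒path E (record { rep = rep p })
           (≤ᴮ-respˡ (≈-sym p≈) (⋆-product-stableʳ E (⟨⟩-mono (⋖⇒⊆ {J} {K} J⋖K) (≤ᴮlongest⇒∈ J b≤)) y≤)))
      λ (a , b′ , a∈ , b′∈ , x≈) → a , b′ , a∈ , ⟨⟩-mono (⋖⇒⊆ {J} {K} J⋖K) b′∈ , x≈

  path⇔max≤ : ∀ {I J} (E : Expression I J) (p q : Coset I J) → Expresses E q → Path E p ⇔ max p ≤ᴮ max q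
  path⇔max≤ E p q maxq≈ = mk⇔
    (λ path → max-absorbs p (rep∈elements p) (max∈ p) (max-LeftMax q) (max-RightMax q)
                (≤ᴮ-respʳ (≈-sym maxq≈) (path⇒≤ᴮ path)))
    (λ max≤ → ≤ᴮ⇒path E p (≤ᴮ-respʳ maxq≈ (≤ᴮ-trans (elements≤max p (rep∈elements p)) max≤)))


  -- Finitary subsets

  -- `Finitary` asks for a predicate at level 0. `True` depends only on the Boolean of a decision
  -- and so lives there; excluded middle supplies the decision.
  resize : ∀ {a} → Pred S a → Pred S 0ℓ
  resize P s = True (em {P = P s})

  enumerated⇒finite : ∀ {P : Pred Carrier (c ⊔ e ⊔ s)} xs → (∀ {x y} → x ≈ y → P x → P y) →
    (∀ {x} → P x → x ∈ₗ xs) → Finite P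
  enumerated⇒finite {P} xs resp P⇒∈ = filter P? xs , λ x → mk⇔
    (λ Px → ∈-filter⁺ setoid P? resp (P⇒∈ Px) Px)
    (λ x∈ → proj₂ (∈-filter⁻ setoid P? resp {xs = xs} x∈))
    where
    P? = λ x → em {P = P x}

  lower-enumeration : ∀ w → ∃ λ xs → ∀ {y} → y ≤ᴮ w → y ∈ₗ xs
  lower-enumeration w = let xs , ∈xs = enumerate (reducedWord w) in
    xs , λ y≤ → ∈xs (≤ᴮ-respʳ (≈-sym (foldr-act-reducedWord w)) y≤)
    where
    enumerate : ∀ u → ∃ λ xs → ∀ {y} → y ≤ᴮ foldr act ε u → y ∈ₗ xs
    enumerate [] = ε ∷ [] , λ y≤ → here (≤ᴮ-ε y≤)
    enumerate (s ∷ u) with xs , ∈xs ← enumerate u = xs ++ map (gen s ∙_) xs , λ {y} y≤ → member (≤ᴮ-act⁻ s y≤)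
      where
      member : ∀ {y} → y ≤ᴮ _ ⊎ gen s ∙ y ≤ᴮ _ → y ∈ₗ (xs ++ map (gen s ∙_) xs)
      member (inj₁ y≤)  = ∈-++⁺ˡ setoid (∈xs y≤)
      member (inj₂ sy≤) = ∈-++⁺ʳ setoid xs
        (∈-resp-≈ setoid (gen-cancelˡ s _) (∈-map⁺ setoid setoid ∙-congˡ (∈xs sy≤)))

  subFinitary : (R : Finitary) (K : Pred S 0ℓ) → K ⊆ set R → Finitary
  subFinitary R K K⊆R = record
    { set    = K
    ; finite = enumerated⇒finite (proj₁ (finite R)) ⟨≈⟩
                 (λ x∈ → Equivalence.to (proj₂ (finite R) _) (⟨⟩-mono K⊆R x∈)) }

  -- By `RightMax-∙` the subgroup generated by the right descents lies in D(w), which is finite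
  -- since D(s * w) = D(w) ∪ s D(w).
  rightDescents : Carrier → Finitary
  rightDescents w = record
    { set    = R
    ; finite = enumerated⇒finite (proj₁ (lower-enumeration w)) ⟨≈⟩
                 (λ x∈ → proj₂ (lower-enumeration w) (≤ᴮ-respˡ (identityˡ _)
                   (RightMax-∙ {R} {w} toWitness x∈ (ε≤ᴮ w)))) }
    where
    R : Pred S 0ℓ
    R = resize (λ s → ℓ (w ∙ gen s) < ℓ w)

  -- Expressions add and remove elements of R one by one, which calls for a list of them. It is
  -- drawn from the list of W_R: as `gen` is injective, one r for each listed element suffices.
  set-enumeration : (R : Finitary) → ∃ λ rs → ∀ {r} → r ∈ set R → r ∈ˢ rs
  set-enumeration R = let rs , ∈rs = enumerate (proj₁ (finite R)) in
    rs , λ r∈ → ∈rs (Equivalence.to (proj₂ (finite R) _) (⟨gen⟩ r∈))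
    where
    enumerate : ∀ xs → ∃ λ rs → ∀ {r} → gen r ∈ₗ xs → r ∈ˢ rs
    enumerate [] = [] , λ ()
    enumerate (x ∷ xs) with em {P = ∃ λ r → gen r ≈ x} | enumerate xs
    ... | yes (r , r≈x) | rs , ∈rs = r ∷ rs , λ
      { (here r′≈x)  → here (gen-distinct (≈-trans r′≈x (≈-sym r≈x)))
      ; (there r′∈) → there (∈rs r′∈) }
    ... | no ∄r | rs , ∈rs = rs , λ
      { (here r′≈x)  → contradiction (_ , r′≈x) ∄r
      ; (there r′∈) → ∈rs r′∈ }

  -- Shortest coset representatives

  ℓ-minimum : ∀ {a} (P : Pred Carrier a) {x} → P x → ∃ λ w → P w × (∀ {y} → P y → ℓ w ≤ ℓ y)
  ℓ-minimum P {x} Px = go Px (<-wellFounded (ℓ x))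
    where
    go : ∀ {x} → P x → Acc _<_ (ℓ x) → ∃ λ w → P w × (∀ {y} → P y → ℓ w ≤ ℓ y)
    go {x} Px (acc rec) with em {P = ∃ λ y → P y × ℓ y < ℓ x}
    ... | yes (y , Py , y<x) = go Py (rec y<x)
    ... | no ∄y = x , Px , λ Py → ℕ.≮⇒≥ λ y<x → ∄y (_ , Py , y<x)

  RightShortest : Pred S 0ℓ → Pred Carrier (c ⊔ e ⊔ s)
  RightShortest R z = ∀ {g} → g ∈ ⟨ R ⟩ → ℓ z ≤ ℓ (z ∙ g)

  RightMin⇒RightShortest : ∀ {R z} → RightMin R z → RightShortest R z
  RightMin⇒RightShortest {z = z} right g∈ = ≤ᴮ⇒ℓ≤ (RightMin-∙ {w = z} right g∈ ≤ᴮ-reflexive)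

  RightShortest⇒RightMin : ∀ {R z} → RightShortest R z → RightMin R z
  RightShortest⇒RightMin {z = z} short {r} r∈ with ℓ-∙-gen r z
  ... | inj₁ lt = lt
  ... | inj₂ gt = contradiction gt (ℕ.≤⇒≯ (short (⟨gen⟩ r∈)))

  RightMin∨descent : ∀ R z → RightMin R z ⊎ (∃ λ r → r ∈ R × ℓ (z ∙ gen r) < ℓ z)
  RightMin∨descent R z with em {P = ∃ λ r → r ∈ R × ℓ (z ∙ gen r) < ℓ z}
  ... | yes descent = inj₂ descent
  ... | no ∄r = inj₁ λ {r} r∈ → case r∈ (ℓ-∙-gen r z)
    where
    case : ∀ {r} → r ∈ R → ℓ z < ℓ (z ∙ gen r) ⊎ ℓ (z ∙ gen r) < ℓ z → ℓ z < ℓ (z ∙ gen r)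
    case r∈ (inj₁ lt) = lt
    case r∈ (inj₂ gt) = contradiction (_ , r∈ , gt) ∄r

  RightMin∈⇒ε : ∀ {R z} → z ∈ ⟨ R ⟩ → RightMin R z → z ≈ ε
  RightMin∈⇒ε {z = z} z∈ right = ≤ᴮ-ε (≤ᴮ-respʳ (inverseʳ z)
    (RightMin-∙ {w = z} right (⟨⁻¹⟩ z∈) ≤ᴮ-reflexive))

  -- Removing a right descent that belongs to I keeps v in W_I, and only ε has no such descent by
  -- `RightMin∈⇒ε`. So v is reached from ε by appending letters of I, each raising the length.
  ⟨⟩-induction : ∀ {a} {I} (P : Pred Carrier a) → (∀ {x y} → x ≈ y → P x → P y) → P ε →
    (∀ {v k} → k ∈ I → v ∈ ⟨ I ⟩ → ℓ v < ℓ (v ∙ gen k) → P v → P (v ∙ gen k)) →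
    ∀ {v} → v ∈ ⟨ I ⟩ → P v
  ⟨⟩-induction {I = I} P resp Pε step {v} v∈ = go v∈ (<-wellFounded (ℓ v))
    where
    go : ∀ {v} → v ∈ ⟨ I ⟩ → Acc _<_ (ℓ v) → P v
    go {v} v∈ (acc rec) with RightMin∨descent I v
    ... | inj₁ right = resp (≈-sym (RightMin∈⇒ε v∈ right)) Pε
    ... | inj₂ (k , k∈ , lt) = resp (gen-cancelʳ k v)
      (step k∈ vk∈ (ℕ.<-≤-trans lt (ℓ-mono (≈-sym (gen-cancelʳ k v)))) (go vk∈ (rec lt)))
      where
      vk∈ : v ∙ gen k ∈ ⟨ I ⟩
      vk∈ = ⟨∙⟩ v∈ (⟨gen⟩ k∈)

  -- Suppose that k lengthens v but shortens z v, and put u = v k v⁻¹ and τ = z u z⁻¹. Then 1 = η(z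
  -- v, τ) = η(z, τ) + η(v, u) with η(v, u) = 0, so τ z = z u is shorter than z although u ∈ W_R.
  RightShortest-ℓ : ∀ {R z} → RightShortest R z → ∀ {v} → v ∈ ⟨ R ⟩ → ℓ (z ∙ v) ≡ ℓ z + ℓ v
  RightShortest-ℓ {R} {z} short = ⟨⟩-induction (λ v → ℓ (z ∙ v) ≡ ℓ z + ℓ v)
    (λ x≈y → ≡.subst₂ (λ a b → a ≡ ℓ z + b) (ℓ-cong (∙-congˡ x≈y)) (ℓ-cong x≈y))
    (≡.trans (ℓ-cong (identityʳ z)) (≡.trans (≡.sym (ℕ.+-identityʳ _)) (cong (ℓ z +_) (≡.sym ℓ-ε))))
    step
    where
    step : ∀ {v k} → k ∈ R → v ∈ ⟨ R ⟩ → ℓ v < ℓ (v ∙ gen k) → ℓ (z ∙ v) ≡ ℓ z + ℓ v →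
           ℓ (z ∙ (v ∙ gen k)) ≡ ℓ z + ℓ (v ∙ gen k)
    step {v} {k} k∈ v∈ v<vk additive = ℕ.≤-antisym (ℓ-∙ z (v ∙ gen k)) (ℕ.≤-trans
        (ℕ.+-monoʳ-≤ (ℓ z) (ℕ.≤-trans (ℓ-∙ v (gen k)) (ℕ.+-monoʳ-≤ (ℓ v) (ℓ-gen k))))
        (≡.subst₂ _≤_ (≡.trans (cong suc additive) (≡.trans (ℕ.+-comm 1 _) (ℕ.+-assoc (ℓ z) (ℓ v) 1)))
                      (ℓ-cong (assoc z v (gen k))) zv<zvk))
      where
      u τ : Carrier
      u = v ∙ gen k ∙ v ⁻¹
      τ = z ∙ u ∙ z ⁻¹
      τ∈ : τ ∈ Reflection
      τ∈ = conjugate-reflection z (conjugate-reflection v (gen-reflection k) ≈-refl) ≈-refl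
      zv<zvk : ℓ (z ∙ v) < ℓ (z ∙ v ∙ gen k)
      zv<zvk with ℓ-∙-gen k (z ∙ v)
      ... | inj₁ lt = lt
      ... | inj₂ gt = contradiction (short (⟨∙⟩ (⟨∙⟩ v∈ (⟨gen⟩ k∈)) (⟨⁻¹⟩ v∈)))
          (ℕ.<⇒≱ (ℕ.≤-<-trans (ℓ-mono (≈-sym (solve 2 (λ z u → z ⊕ u ⊕ ⊖ z ⊕ z ⊜ z ⊕ u) ≈-refl z u))) (η⇒ℓ< z τ odd)))
        where
        v-even : η v (z ⁻¹ ∙ τ ∙ z) ≡ false
        v-even = ≡.trans (η-cong ≈-refl (solve 2 (λ z u → ⊖ z ⊕ (z ⊕ u ⊕ ⊖ z) ⊕ z ⊜ u) ≈-refl z u))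
          (ℓ>⇒η u v (ℕ.<-≤-trans v<vk (ℓ-mono (solve 2 (λ v k → v ⊕ k ⊜ v ⊕ k ⊕ ⊖ v ⊕ v) ≈-refl v (gen k)))))
        odd : η z τ ≡ true
        odd = ≡.trans (≡.sym (xor-identityʳ (η z τ))) (≡.trans (cong (η z τ xor_) (≡.sym v-even))
          (≡.trans (≡.sym (η-∙ z v τ)) (ℓ<⇒η τ∈ (z ∙ v) (ℕ.≤-<-trans (ℓ-mono
            (solve 3 (λ z v k → z ⊕ (v ⊕ k ⊕ ⊖ v) ⊕ ⊖ z ⊕ (z ⊕ v) ⊜ z ⊕ v ⊕ k) ≈-refl z v (gen k))) gt))))

  -- Take z of least length in w W_R. By additivity of length the remaining factor in W_R inherits
  -- the right descents of w in R, and is therefore w_R.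
  RightMax-decomposition : ∀ (R : Finitary) {w} → RightMax (set R) w →
    ∃ λ z → RightShortest (set R) z × w ≈ z ∙ longest R
  RightMax-decomposition R {w} right
    with z , (g , g∈ , w≈) , z-min ← ℓ-minimum (λ z → ∃ λ g → g ∈ ⟨ set R ⟩ × w ≈ z ∙ g)
           (ε , ⟨ε⟩ , ≈-sym (identityʳ w))
    = z , short , ≈-trans w≈ (∙-congˡ (RightMax⇒longest R g∈ λ {r} r∈ →
        ℕ.+-cancelˡ-< (ℓ z) _ _ (≡.subst₂ _<_
          (≡.trans (ℓ-cong (≈-trans (∙-congʳ w≈) (assoc _ _ _)))
                   (RightShortest-ℓ {z = z} short (⟨∙⟩ g∈ (⟨gen⟩ r∈))))
          (≡.trans (ℓ-cong w≈) (RightShortest-ℓ {z = z} short g∈)) (right r∈))))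
    where
    short : RightShortest (set R) z
    short {h} h∈ = z-min (h ⁻¹ ∙ g , ⟨∙⟩ (⟨⁻¹⟩ h∈) g∈ ,
      ≈-trans w≈ (solve 3 (λ z h g → z ⊕ g ⊜ z ⊕ h ⊕ (⊖ h ⊕ g)) ≈-refl z h g))

  RightShortest-⊆ : ∀ {K R z} → K ⊆ R → RightShortest R z → RightShortest K z
  RightShortest-⊆ K⊆R short g∈ = short (⟨⟩-mono K⊆R g∈)

  RightShortest⇒RightMax : ∀ (L : Finitary) {z} → RightShortest (set L) z → RightMax (set L) (z ∙ longest L)
  RightShortest⇒RightMax L {z} short {l} l∈ = ≡.subst₂ _<_
    (≡.sym (≡.trans (ℓ-cong (assoc _ _ _)) (RightShortest-ℓ {z = z} short (⟨∙⟩ (longest∈ L) (⟨gen⟩ l∈)))))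
    (≡.sym (RightShortest-ℓ {z = z} short (longest∈ L)))
    (ℕ.+-monoʳ-< (ℓ z) (longest-RightMax L l∈))

  longest-mono : ∀ K L → set K ⊆ set L → longest K ≤ᴮ longest L
  longest-mono K L K⊆L = ∈⇒≤ᴮlongest L (⟨⟩-mono K⊆L (longest∈ K))

  longest-cong : ∀ K L → set K ≐ set L → longest K ≈ longest L
  longest-cong K L (K⊆L , L⊆K) = ≤ᴮ-antisym (longest-mono K L K⊆L) (longest-mono L K L⊆K)

  longest-quotient-ℓ : ∀ K P → set K ⊆ set P → ℓ (longest P ∙ longest K ⁻¹) + ℓ (longest K) ≡ ℓ (longest P)
  longest-quotient-ℓ K P K⊆P =
    let z , short , w≈ = RightMax-decomposition K {longest P} (λ k∈ → longest-RightMax P (K⊆P k∈)) in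
    ≡.trans (cong (_+ ℓ (longest K)) (ℓ-cong (≈-trans (∙-congʳ w≈)
              (solve 2 (λ z w → z ⊕ w ⊕ ⊖ w ⊜ z) ≈-refl z (longest K)))))
      (≡.trans (≡.sym (RightShortest-ℓ {z = z} short (longest∈ K))) (ℓ-cong (≈-sym w≈)))

  -- Reduced expressions

  product : List Carrier → Carrier
  product = foldr _∙_ ε

  product-∷ʳ : ∀ xs x → product (xs ∷ʳ x) ≈ product xs ∙ x
  product-∷ʳ []       x = solve 1 (λ x → x ⊕ 𝟙 ⊜ 𝟙 ⊕ x) ≈-refl x
  product-∷ʳ (y ∷ xs) x = ≈-trans (∙-congˡ (product-∷ʳ xs x)) (≈-sym (assoc _ _ _))

  total-∷ʳ : ∀ xs x → sum (map ℓ (xs ∷ʳ x)) ≡ sum (map ℓ xs) + ℓ x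
  total-∷ʳ xs x = ≡.trans (cong sum (map-++ ℓ xs (x ∷ [])))
    (≡.trans (sum-++ (map ℓ xs) _) (cong (sum (map ℓ xs) +_) (ℕ.+-identityʳ (ℓ x))))

  quotient : Finitary × Finitary → Carrier
  quotient (K , L) = longest K ∙ longest L ⁻¹

  -- The factor of the last peak is kept apart from the quotients because the next ascending step
  -- may still replace that peak.
  TurnsReduced : Turns → Carrier → Set e
  TurnsReduced (turns ps P _) w =
    product (map quotient ps) ∙ longest P ≈ w × sum (map ℓ (map quotient ps)) + ℓ (longest P) ≡ ℓ w

  record ReducedExpression (I J : Finitary) (w : Carrier) : Set (lsuc 0ℓ ⊔ c ⊔ e ⊔ s) where
    field
      expression    : Expression I J
      expresses     : ⋆-product expression ≈ w
      turns-reduced : TurnsReduced (multistep expression) w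
  open ReducedExpression

  ReducedExpression-cong : ∀ {I J w w′} → w ≈ w′ → ReducedExpression I J w → ReducedExpression I J w′
  ReducedExpression-cong w≈w′ R = record
    { expression    = expression R
    ; expresses     = ≈-trans (expresses R) w≈w′
    ; turns-reduced = ≈-trans (proj₁ (turns-reduced R)) w≈w′ , ≡.trans (proj₂ (turns-reduced R)) (ℓ-cong w≈w′) }

  -- The turns do not record the current subset K; this invariant is what allows `turns-up` to
  -- relate w_P and w_K.
  PeakAbove : Turns → Finitary → Set s
  PeakAbove (turns _ P direction) K = set K ⊆ set P × (direction ≡ ascending → set P ⊆ set K)

  peak-above : ∀ {I J} (E : Expression I J) → PeakAbove (multistep E) J
  peak-above [ I≐J ] = proj₂ I≐J , λ _ → proj₁ I≐J
  peak-above (E ▷⁺ _) with multistep E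
  ... | turns _ _ ascending  = (λ j∈ → j∈) , λ _ j∈ → j∈
  ... | turns _ _ descending = (λ j∈ → j∈) , λ _ j∈ → j∈
  peak-above {J = J} (_▷⁻_ {K = K} E J⋖K) with multistep E | peak-above E
  ... | turns _ _ _ | K⊆P , _ = (λ j∈ → K⊆P (⋖⇒⊆ {J} {K} J⋖K j∈)) , λ ()

  coset-ℓ : ∀ {K J z} → RightShortest (set J) z → set K ⊆ set J → ℓ (z ∙ longest K) ≡ ℓ z + ℓ (longest K)
  coset-ℓ {K} {z = z} short K⊆J = RightShortest-ℓ {z = z} short (⟨⟩-mono K⊆J (longest∈ K))

  -- The point is that the quotients of the longer expression multiply to z with lengths adding up
  -- to ℓ z. In an ascending run w_P = w_K cancels from the hypothesis; at a new turn the added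
  -- quotient w_P w_K⁻¹ removes w_K. The lengths split because z is shortest in z W_J.
  turns-up : ∀ {I K J} (E : Expression I K) (K⋖J : K ⋖ J) {z} → RightShortest (set J) z →
    TurnsReduced (multistep E) (z ∙ longest K) → TurnsReduced (multistep (E ▷⁺ K⋖J)) (z ∙ longest J)
  turns-up {K = K} {J} E K⋖J {z} short reduced with multistep E | peak-above E | reduced
  ... | turns ps P ascending | K⊆P , P⊆K | Π≈ , Σ≡ =
      ∙-congʳ (∙-cancelʳ (longest K) _ _ (≈-trans (∙-congˡ (≈-sym P≈K)) Π≈))
    , ≡.trans (cong (_+ ℓ (longest J)) (ℕ.+-cancelʳ-≡ (ℓ (longest K)) _ _
        (≡.trans (cong (_ +_) (ℓ-cong (≈-sym P≈K))) (≡.trans Σ≡ (coset-ℓ {K} {J} short (⋖⇒⊆ {K} {J} K⋖J))))))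
        (≡.sym (coset-ℓ {J} {J} short (λ j∈ → j∈)))
    where
    P≈K : longest P ≈ longest K
    P≈K = longest-cong P K (P⊆K ≡.refl , K⊆P)
  ... | turns ps P descending | K⊆P , _ | Π≈ , Σ≡
    rewrite map-++ quotient ps ((P , K) ∷ []) =
      ∙-congʳ (begin
        product (qs ∷ʳ PK)                      ≈⟨ product-∷ʳ qs PK ⟩
        product qs ∙ (longest P ∙ longest K ⁻¹) ≈⟨ assoc _ _ _ ⟨
        product qs ∙ longest P ∙ longest K ⁻¹   ≈⟨ ∙-congʳ Π≈ ⟩
        z ∙ longest K ∙ longest K ⁻¹            ≈⟨ solve 2 (λ z w → z ⊕ w ⊕ ⊖ w ⊜ z) ≈-refl z (longest K) ⟩
        z                                       ∎)
    , ≡.trans (cong (_+ ℓ (longest J)) (ℕ.+-cancelʳ-≡ (ℓ (longest K)) _ _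
        (≡.trans (cong (_+ ℓ (longest K)) (total-∷ʳ qs PK))
        (≡.trans (ℕ.+-assoc (sum (map ℓ qs)) (ℓ PK) _)
        (≡.trans (cong (sum (map ℓ qs) +_) (longest-quotient-ℓ K P K⊆P))
        (≡.trans Σ≡ (coset-ℓ {K} {J} short (⋖⇒⊆ {K} {J} K⋖J))))))))
        (≡.sym (coset-ℓ {J} {J} short (λ j∈ → j∈)))
    where
    qs : List Carrier
    qs = map quotient ps
    PK : Carrier
    PK = longest P ∙ longest K ⁻¹

  -- Here (z w_K) * w_J = z w_J: the right side has all of J as right descents and so absorbs W_J,
  -- and conversely z ≤ z w_K.
  ascend : ∀ {I K J z} → RightShortest (set J) z → K ⋖ J →
    ReducedExpression I K (z ∙ longest K) → ReducedExpression I J (z ∙ longest J)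
  ascend {I} {K} {J} {z} short K⋖J R = record
    { expression    = E ▷⁺ K⋖J
    ; expresses     = ≤ᴮ-antisym below above
    ; turns-reduced = turns-up E K⋖J {z} short (turns-reduced R) }
    where
    E = expression R
    K⊆J = ⋖⇒⊆ {K} {J} K⋖J
    zJ-RightMax : RightMax (set J) (z ∙ longest J)
    zJ-RightMax = RightShortest⇒RightMax J short
    zK≤zJ : z ∙ longest K ≤ᴮ z ∙ longest J
    zK≤zJ = ≤ᴮ-respˡ (solve 3 (λ z k j → z ⊕ j ⊕ (⊖ j ⊕ k) ⊜ z ⊕ k) ≈-refl z (longest K) (longest J))
      (RightMax-∙ {w = z ∙ longest J} zJ-RightMax
        (⟨∙⟩ (⟨⁻¹⟩ (longest∈ J)) (⟨⟩-mono K⊆J (longest∈ K))) ≤ᴮ-reflexive)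
    z≤zK : z ≤ᴮ z ∙ longest K
    z≤zK = ≤ᴮ-respˡ (solve 2 (λ z k → z ⊕ k ⊕ ⊖ k ⊜ z) ≈-refl z (longest K))
      (RightMax-∙ {w = z ∙ longest K} (RightShortest⇒RightMax K (RightShortest-⊆ {z = z} K⊆J short))
        (⟨⁻¹⟩ (longest∈ K)) ≤ᴮ-reflexive)
    below : ⋆-product E ⋆ longest J ≤ᴮ z ∙ longest J
    below with a , b , a≤ , b≤ , ab≈ ← ⋆-lower⁻ {⋆-product E} {longest J} ≤ᴮ-reflexive =
      ≤ᴮ-respˡ (≈-sym ab≈) (RightMax-∙ {w = z ∙ longest J} zJ-RightMax (≤ᴮlongest⇒∈ J b≤)
        (≤ᴮ-trans a≤ (≤ᴮ-respˡ (≈-sym (expresses R)) zK≤zJ)))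
    above : z ∙ longest J ≤ᴮ ⋆-product E ⋆ longest J
    above = ⋆-lower⁺ (z , longest J , ≤ᴮ-respʳ (≈-sym (expresses R)) z≤zK , ≤ᴮ-reflexive , ≈-refl)

  descend : ∀ {I K J w} → J ⋖ K → ReducedExpression I K w → ReducedExpression I J w
  descend {I} {K} {J} {w} J⋖K R = record
    { expression    = E ▷⁻ J⋖K
    ; expresses     = ≈-trans (≤ᴮ-antisym below (⋆-lower⁺ (⋆-product E , ε , ≤ᴮ-reflexive , ε≤ᴮ _ , ≈-sym (identityʳ _))))
                              (expresses R)
    ; turns-reduced = turns-reduced′ }
    where
    E = expression R
    below : ⋆-product E ⋆ longest J ≤ᴮ ⋆-product E
    below with a , b , a≤ , b≤ , ab≈ ← ⋆-lower⁻ {⋆-product E} {longest J} ≤ᴮ-reflexive =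
      ≤ᴮ-respˡ (≈-sym ab≈) (⋆-product-stableʳ E (⟨⟩-mono (⋖⇒⊆ {J} {K} J⋖K) (≤ᴮlongest⇒∈ J b≤)) a≤)
    turns-reduced′ : TurnsReduced (multistep (_▷⁻_ {J = J} E J⋖K)) w
    turns-reduced′ with multistep E | turns-reduced R
    ... | turns _ _ _ | reduced = reduced

  ⋆-congˡ : ∀ {x y z} → y ≈ z → x ⋆ y ≈ x ⋆ z
  ⋆-congˡ {x} y≈z = ≤ᴮ-antisym (half y≈z) (half (≈-sym y≈z))
    where
    half : ∀ {y z} → y ≈ z → x ⋆ y ≤ᴮ x ⋆ z
    half {y} y≈z with a , b , a≤ , b≤ , ab≈ ← ⋆-lower⁻ {x} {y} ≤ᴮ-reflexive =
      ⋆-lower⁺ (a , b , a≤ , ≤ᴮ-respʳ y≈z b≤ , ab≈)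

  -- Equal subsets may be distinct `Finitary` records with different enumerations, and `Expression`
  -- is indexed by the record. Only the last step of the expression refers to K, so only that step
  -- is rebuilt.
  retarget : ∀ {I K J w} → set K ≐ set J → ReducedExpression I K w → ReducedExpression I J w
  retarget {K = K} {J} {w} K≐J@(K⊆J , J⊆K) record { expression = E ; expresses = ⋆≈ ; turns-reduced = reduced } = go E ⋆≈ reduced
    where
    J≈K : longest J ≈ longest K
    J≈K = longest-cong J K (J⊆K , K⊆J)
    go : ∀ {I} (E : Expression I K) → ⋆-product E ≈ w → TurnsReduced (multistep E) w → ReducedExpression I J w
    go [ I⊆K , K⊆I ] ⋆≈ reduced = record
      { expression    = [ (λ i∈ → K⊆J (I⊆K i∈)) , (λ j∈ → K⊆I (J⊆K j∈)) ]
      ; expresses     = ⋆≈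
      ; turns-reduced = reduced }
    go (E ▷⁺ (s , s∉ , K⊆ , ⊆K)) ⋆≈ reduced = record
      { expression    = E ▷⁺ (s , s∉ , (λ j∈ → K⊆ (J⊆K j∈)) , λ l∈ → K⊆J (⊆K l∈))
      ; expresses     = ≈-trans (⋆-congˡ {⋆-product E} J≈K) ⋆≈
      ; turns-reduced = turns-reduced′ reduced }
      where
      turns-reduced′ : TurnsReduced (multistep (_▷⁺_ {J = K} E (s , s∉ , K⊆ , ⊆K))) w →
        TurnsReduced (multistep (_▷⁺_ {J = J} E (s , s∉ , (λ j∈ → K⊆ (J⊆K j∈)) , λ l∈ → K⊆J (⊆K l∈)))) w
      turns-reduced′ reduced with multistep E | reduced
      ... | turns ps _ ascending  | Π≈ , Σ≡ =
        ≈-trans (∙-congˡ J≈K) Π≈ , ≡.trans (cong (sum (map ℓ (map quotient ps)) +_) (ℓ-cong J≈K)) Σ≡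
      ... | turns ps P descending | Π≈ , Σ≡ =
        ≈-trans (∙-congˡ J≈K) Π≈ , ≡.trans (cong (_ +_) (ℓ-cong J≈K)) Σ≡
    go (_▷⁻_ {K = L} E (s , s∉ , L⊆ , ⊆L)) ⋆≈ reduced = record
      { expression    = E ▷⁻ J⋖L
      ; expresses     = ≈-trans (⋆-congˡ {⋆-product E} J≈K) ⋆≈
      ; turns-reduced = turns-reduced′ reduced }
      where
      J⋖L : J ⋖ L
      J⋖L = s , (λ s∈ → s∉ (J⊆K s∈))
              , (λ l∈ → Sum.map₁ K⊆J (L⊆ l∈))
              , λ j∈ → ⊆L (Sum.map₁ J⊆K j∈)
      turns-reduced′ : TurnsReduced (multistep (_▷⁻_ {J = K} E (s , s∉ , L⊆ , ⊆L))) w →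
        TurnsReduced (multistep (_▷⁻_ {J = J} E J⋖L)) w
      turns-reduced′ reduced with multistep E | reduced
      ... | turns _ _ _ | reduced = reduced

  -- Runs of single steps between nested finitary subsets

  module _ {I R : Finitary} where
    -- The list may contain repetitions and elements outside R or already in K; the test on each
    -- entry skips them. Every intermediate subset lies in R, so z remains shortest for it.
    ascend-list : ∀ {z} → RightShortest (set R) z → ∀ rs (K : Finitary) → set K ⊆ set R →
      (∀ {r} → r ∈ set R → r ∈ set K ⊎ r ∈ˢ rs) →
      ReducedExpression I K (z ∙ longest K) → ReducedExpression I R (z ∙ longest R)
    ascend-list short [] K K⊆R R⊆ E =
      ReducedExpression-cong (∙-congˡ (longest-cong K R K≐R)) (retarget {K = K} {R} K≐R E)
      where
      only : ∀ {r} → r ∈ set K ⊎ r ∈ˢ [] → r ∈ set K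
      only (inj₁ r∈) = r∈
      K≐R : set K ≐ set R
      K≐R = K⊆R , λ r∈ → only (R⊆ r∈)
    ascend-list {z} short (r ∷ rs) K K⊆R R⊆ E with em {P = r ∈ set R × r ∉ set K}
    ... | yes (r∈ , r∉) = ascend-list {z} short rs K+r K+r⊆R split
        (ascend {K = K} {K+r} {z} (RightShortest-⊆ {z = z} K+r⊆R short)
          (r , r∉ , toWitness , fromWitness) E)
      where
      K+r⊆R : resize (set K ∪ ｛ r ｝) ⊆ set R
      K+r⊆R s∈ with toWitness s∈
      ... | inj₁ s∈K    = K⊆R s∈K
      ... | inj₂ ≡.refl = r∈
      K+r : Finitary
      K+r = subFinitary R (resize (set K ∪ ｛ r ｝)) K+r⊆R
      split : ∀ {s} → s ∈ set R → s ∈ set K+r ⊎ s ∈ˢ rs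
      split s∈ with R⊆ s∈
      ... | inj₁ s∈K            = inj₁ (fromWitness (inj₁ s∈K))
      ... | inj₂ (here ≡.refl)  = inj₁ (fromWitness (inj₂ ≡.refl))
      ... | inj₂ (there s∈rs)   = inj₂ s∈rs
    ... | no ¬r = ascend-list {z} short rs K K⊆R split E
      where
      split : ∀ {s} → s ∈ set R → s ∈ set K ⊎ s ∈ˢ rs
      split s∈ with R⊆ s∈
      ... | inj₁ s∈K            = inj₁ s∈K
      ... | inj₂ (there s∈rs)   = inj₂ s∈rs
      ... | inj₂ (here ≡.refl) with em {P = r ∈ set K}
      ...   | yes r∈K = inj₁ r∈K
      ...   | no  r∉K = contradiction (s∈ , r∉K) ¬r

    ascend-to : ∀ {z} → RightShortest (set R) z → (K : Finitary) → set K ⊆ set R →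
      ReducedExpression I K (z ∙ longest K) → ReducedExpression I R (z ∙ longest R)
    ascend-to {z} short K K⊆R with rs , R⊆rs ← set-enumeration R =
      ascend-list {z} short rs K K⊆R (λ r∈ → inj₂ (R⊆rs r∈))

    descend-list : ∀ {w} rs (K : Finitary) → set R ⊆ set K → (∀ {k} → k ∈ set K → k ∈ set R ⊎ k ∈ˢ rs) →
      ReducedExpression I K w → ReducedExpression I R w
    descend-list [] K R⊆K K⊆ E = retarget {K = K} {R} ((λ k∈ → only (K⊆ k∈)) , R⊆K) E
      where
      only : ∀ {k} → k ∈ set R ⊎ k ∈ˢ [] → k ∈ set R
      only (inj₁ k∈) = k∈
    descend-list {w} (r ∷ rs) K R⊆K K⊆ E with em {P = r ∈ set K × r ∉ set R}
    ... | yes (r∈ , r∉) = descend-list rs K-r (λ s∈ → fromWitness (R⊆K s∈ , λ r≡s → r∉ (subst (_∈ set R) (≡.sym r≡s) s∈))) split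
        (descend {K = K} {K-r} (r , (λ r∈′ → proj₂ (toWitness r∈′) ≡.refl) , cover , covered) E)
      where
      K-r : Finitary
      K-r = subFinitary K (resize (λ s → s ∈ set K × ¬ r ≡ s)) (λ s∈ → proj₁ (toWitness s∈))
      cover : set K ⊆ set K-r ∪ ｛ r ｝
      cover {s} s∈ with em {P = r ≡ s}
      ... | yes r≡s = inj₂ r≡s
      ... | no  r≢s = inj₁ (fromWitness (s∈ , r≢s))
      covered : set K-r ∪ ｛ r ｝ ⊆ set K
      covered (inj₁ s∈)     = proj₁ (toWitness s∈)
      covered (inj₂ ≡.refl) = r∈
      split : ∀ {k} → k ∈ set K-r → k ∈ set R ⊎ k ∈ˢ rs
      split k∈ with k∈K , r≢k ← toWitness k∈ with K⊆ k∈K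
      ... | inj₁ k∈R           = inj₁ k∈R
      ... | inj₂ (here k≡r)    = contradiction (≡.sym k≡r) r≢k
      ... | inj₂ (there k∈rs)  = inj₂ k∈rs
    ... | no ¬r = descend-list rs K R⊆K split E
      where
      split : ∀ {k} → k ∈ set K → k ∈ set R ⊎ k ∈ˢ rs
      split k∈ with K⊆ k∈
      ... | inj₁ k∈R           = inj₁ k∈R
      ... | inj₂ (there k∈rs)  = inj₂ k∈rs
      ... | inj₂ (here ≡.refl) with em {P = r ∈ set R}
      ...   | yes r∈R = inj₁ r∈R
      ...   | no  r∉R = contradiction (k∈ , r∉R) ¬r

    descend-to : ∀ {w} (K : Finitary) → set R ⊆ set K → ReducedExpression I K w → ReducedExpression I R w
    descend-to K R⊆K with ks , K⊆ks ← set-enumeration K = descend-list ks K R⊆K (λ k∈ → inj₂ (K⊆ks k∈))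

  -- Existence of reduced expressions by induction on length

  LeftMax-cong : ∀ {I w w′} → w ≈ w′ → LeftMax I w → LeftMax I w′
  LeftMax-cong w≈w′ left i∈ = ≡.subst₂ _<_ (ℓ-cong (∙-congˡ w≈w′)) (ℓ-cong w≈w′) (left i∈)

  RightMax-cong : ∀ {I w w′} → w ≈ w′ → RightMax I w → RightMax I w′
  RightMax-cong w≈w′ right i∈ = ≡.subst₂ _<_ (ℓ-cong (∙-congʳ w≈w′)) (ℓ-cong w≈w′) (right i∈)

  -- Deodhar's lemma for i z, in the case that multiplication by i lowers z w_R.
  exchange-through : ∀ (R : Finitary) {z i} → RightShortest (set R) z → ℓ z < ℓ (gen i ∙ z) →
    ℓ (gen i ∙ (z ∙ longest R)) < ℓ (z ∙ longest R) → ∃ λ r → r ∈ set R × gen i ∙ z ≈ z ∙ gen r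
  exchange-through R {z} {i} short z<iz descent with RightMin∨descent (set R) (gen i ∙ z)
  ... | inj₁ right = contradiction descent (ℕ.<⇒≯ (≡.subst₂ _<_
      (≡.sym (RightShortest-ℓ {z = z} short (longest∈ R)))
      (≡.sym (≡.trans (ℓ-cong (≈-sym (assoc _ _ _)))
        (RightShortest-ℓ {z = gen i ∙ z} (RightMin⇒RightShortest {z = gen i ∙ z} right) (longest∈ R))))
      (ℕ.+-monoˡ-< (ℓ (longest R)) z<iz)))
  ... | inj₂ (r , r∈ , izr<iz) = r , r∈ , (begin
      gen i ∙ z                            ≈⟨ gen-cancelʳ r _ ⟨
      gen i ∙ z ∙ gen r ∙ gen r            ≈⟨ ∙-congʳ (solve 3 (λ i z r → i ⊕ z ⊕ r ⊜ i ⊕ z ⊕ r ⊕ ⊖ (i ⊕ z) ⊕ (i ⊕ z)) ≈-refl _ _ _) ⟩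
      τ ∙ (gen i ∙ z) ∙ gen r              ≈⟨ ∙-congʳ (∙-congʳ τ≈i) ⟩
      gen i ∙ (gen i ∙ z) ∙ gen r          ≈⟨ ∙-congʳ (gen-cancelˡ i z) ⟩
      z ∙ gen r                            ∎)
    where
    τ u : Carrier
    τ = gen i ∙ z ∙ gen r ∙ (gen i ∙ z) ⁻¹
    u = z ∙ gen r ∙ z ⁻¹
    uz≈zr : u ∙ z ≈ z ∙ gen r
    uz≈zr = solve 2 (λ z r → z ⊕ r ⊕ ⊖ z ⊕ z ⊜ z ⊕ r) ≈-refl z (gen r)
    u-even : η z (gen i ⁻¹ ∙ τ ∙ gen i) ≡ false
    u-even = ≡.trans
      (η-cong ≈-refl (solve 3 (λ i z r → ⊖ i ⊕ (i ⊕ z ⊕ r ⊕ ⊖ (i ⊕ z)) ⊕ i ⊜ z ⊕ r ⊕ ⊖ z) ≈-refl _ _ _))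
      (ℓ>⇒η u z (ℕ.<-≤-trans (RightShortest⇒RightMin {z = z} short r∈) (ℓ-mono (≈-sym uz≈zr))))
    δ-odd : δ τ (gen i) ≡ true
    δ-odd = ≡.trans (≡.sym (xor-identityʳ _)) (≡.trans (cong (δ τ (gen i) xor_) (≡.sym u-even))
      (≡.trans (≡.sym (η-gen-∙ i z τ)) (ℓ<⇒η (conjugate-reflection (gen i ∙ z) (gen-reflection r) ≈-refl) (gen i ∙ z)
        (ℕ.≤-<-trans (ℓ-mono (solve 3 (λ i z r → i ⊕ z ⊕ r ⊕ ⊖ (i ⊕ z) ⊕ (i ⊕ z) ⊜ i ⊕ z ⊕ r) ≈-refl _ _ _)) izr<iz))))
    τ≈i : τ ≈ gen i
    τ≈i with em {P = τ ≈ gen i} | δ-odd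
    ... | yes τ≈i | _ = τ≈i

  everything : ∀ w → w ∈ ⟨ (λ _ → ⊤) ⟩
  everything w = ⟨≈⟩ (⟦reducedWord⟧ w) (word∈ (reducedWord w))
    where
    word∈ : ∀ u → ⟦ u ⟧ ∈ ⟨ (λ _ → ⊤) ⟩
    word∈ []      = ⟨ε⟩
    word∈ (s ∷ u) = ⟨∙⟩ (⟨gen⟩ tt) (word∈ u)

  -- With w = z w_R as in RightMax-decomposition, put K = R ∩ z⁻¹ I z and y = z w_K. Then
  -- w = y w_K⁻¹ w_R, so an expression of y followed by K ⊂ R ⊃ J is one of w. If y = w
  -- then z = ε and w = w_I, and I ⊂ R ⊃ J is an expression of w.
  module Peel (I : Finitary) {w : Carrier} (left : LeftMax (set I) w)
    {z : Carrier} (short : RightShortest (set (rightDescents w)) z) (w≈ : w ≈ z ∙ longest (rightDescents w))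
    (rec : ∀ {K y} → ℓ y < ℓ w → LeftMax (set I) y → RightMax (set K) y → ReducedExpression I K y) where
    R : Finitary
    R = rightDescents w

    K⊆R : resize (λ k → k ∈ set R × ∃ λ i → i ∈ set I × gen i ∙ z ≈ z ∙ gen k) ⊆ set R
    K⊆R k∈ = proj₁ (toWitness k∈)

    K : Finitary
    K = subFinitary R _ K⊆R

    y : Carrier
    y = z ∙ longest K

    ℓ-y : ℓ y ≡ ℓ z + ℓ (longest K)
    ℓ-y = coset-ℓ {K} {R} {z} short K⊆R

    ℓ-w : ℓ w ≡ ℓ z + ℓ (longest R)
    ℓ-w = ≡.trans (ℓ-cong w≈) (RightShortest-ℓ {z = z} short (longest∈ R))

    y-LeftMax : LeftMax (set I) y
    y-LeftMax {i} i∈ with ℓ-gen-∙ i z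
    ... | inj₂ iz<z = ℕ.≤-<-trans (ℕ.≤-trans (ℓ-mono (≈-sym (assoc _ _ _))) (ℓ-∙ (gen i ∙ z) (longest K)))
        (ℕ.<-≤-trans (ℕ.+-monoˡ-< (ℓ (longest K)) iz<z) (ℕ.≤-reflexive (≡.sym ℓ-y)))
    -- Here i z = z k with k ∈ R, so k lies in K by construction, and i y = z k w_K is shorter than
    -- y because k is a left descent of w_K.
    ... | inj₁ z<iz
      with k , k∈R , iz≈zk ← exchange-through R {z} short z<iz (LeftMax-cong w≈ left i∈)
      = ℕ.≤-<-trans (ℕ.≤-trans (ℓ-mono (≈-trans (≈-sym (assoc _ _ _)) (≈-trans (∙-congʳ iz≈zk) (assoc _ _ _))))
                               (ℓ-∙ z (gen k ∙ longest K)))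
        (ℕ.<-≤-trans (ℕ.+-monoʳ-< (ℓ z) (longest-LeftMax K (fromWitness (k∈R , i , i∈ , iz≈zk)))) (ℕ.≤-reflexive (≡.sym ℓ-y)))

    module _ (ℓw≤ℓy : ℓ w ≤ ℓ y) where
      K≈R : longest K ≈ longest R
      K≈R = ≤ᴮ∧ℓ≥⇒≈ (longest-mono K R K⊆R) (ℕ.+-cancelˡ-≤ (ℓ z) _ _ (≡.subst₂ _≤_ ℓ-w ℓ-y ℓw≤ℓy))

      -- Conjugation by z carries every generator in K to one in I. The bound on ℓ w′ is there for
      -- the length estimate in `z≈ε`.
      commute : ∀ {v} → v ∈ ⟨ set K ⟩ → ∃ λ w′ → w′ ∈ ⟨ set I ⟩ × ℓ w′ ≤ ℓ v × z ∙ v ≈ w′ ∙ z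
      commute = ⟨⟩-induction (λ v → ∃ λ w′ → w′ ∈ ⟨ set I ⟩ × ℓ w′ ≤ ℓ v × z ∙ v ≈ w′ ∙ z)
        (λ x≈y (w′ , w′∈ , ℓ≤ , eq) → w′ , w′∈ , ℕ.≤-trans ℓ≤ (ℓ-mono x≈y) , ≈-trans (∙-congˡ (≈-sym x≈y)) eq)
        (ε , ⟨ε⟩ , ℕ.≤-refl , ≈-trans (identityʳ z) (≈-sym (identityˡ z)))
        step
        where
        step : ∀ {v k} → k ∈ set K → v ∈ ⟨ set K ⟩ → ℓ v < ℓ (v ∙ gen k) →
          (∃ λ w′ → w′ ∈ ⟨ set I ⟩ × ℓ w′ ≤ ℓ v × z ∙ v ≈ w′ ∙ z) →
          ∃ λ w′ → w′ ∈ ⟨ set I ⟩ × ℓ w′ ≤ ℓ (v ∙ gen k) × z ∙ (v ∙ gen k) ≈ w′ ∙ z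
        step {v} {k} k∈ _ v<vk (w′ , w′∈ , ℓ≤ , eq) with _ , i , i∈ , iz≈zk ← toWitness k∈ =
          w′ ∙ gen i , ⟨∙⟩ w′∈ (⟨gen⟩ i∈) ,
          ℕ.≤-trans (ℓ-∙ w′ (gen i)) (ℕ.≤-trans (ℕ.+-mono-≤ ℓ≤ (ℓ-gen i)) (ℕ.≤-trans (ℕ.≤-reflexive (ℕ.+-comm (ℓ v) 1)) v<vk)) ,
          (begin
            z ∙ (v ∙ gen k)      ≈⟨ assoc _ _ _ ⟨
            z ∙ v ∙ gen k        ≈⟨ ∙-congʳ eq ⟩
            w′ ∙ z ∙ gen k       ≈⟨ assoc _ _ _ ⟩
            w′ ∙ (z ∙ gen k)     ≈⟨ ∙-congˡ iz≈zk ⟨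
            w′ ∙ (gen i ∙ z)     ≈⟨ assoc _ _ _ ⟨
            w′ ∙ gen i ∙ z       ∎)

      -- If t were a right descent of z, then w t = w′ z t with w′ no longer than w_R, so w t would
      -- be shorter than w and t would belong to R. But z is shortest in z W_R.
      z≈ε : z ≈ ε
      z≈ε with RightMin∨descent (λ _ → ⊤) z
      ... | inj₁ right = RightMin∈⇒ε (everything z) right
      ... | inj₂ (t , _ , zt<z) with w′ , _ , ℓ≤ , eq ← commute (longest∈ K) =
        contradiction (short (⟨gen⟩ (fromWitness wt<w))) (ℕ.<⇒≱ zt<z)
        where
        wt<w : ℓ (w ∙ gen t) < ℓ w
        wt<w = ℕ.≤-<-trans
          (ℕ.≤-trans (ℓ-mono (≈-trans (∙-congʳ (≈-trans w≈ (≈-trans (∙-congˡ (≈-sym K≈R)) eq))) (assoc _ _ _)))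
                     (ℓ-∙ w′ (z ∙ gen t)))
          (ℕ.<-≤-trans (ℕ.+-mono-≤-< (ℕ.≤-trans ℓ≤ (ℓ-mono K≈R)) zt<z)
                       (ℕ.≤-reflexive (≡.trans (ℕ.+-comm (ℓ (longest R)) (ℓ z)) (≡.sym ℓ-w))))

      w∈I : w ∈ ⟨ set I ⟩
      w∈I with w′ , w′∈ , _ , eq ← commute (longest∈ K) = ⟨≈⟩ (begin
        w′                 ≈⟨ identityʳ w′ ⟨
        w′ ∙ ε             ≈⟨ ∙-congˡ z≈ε ⟨
        w′ ∙ z             ≈⟨ eq ⟨
        z ∙ longest K      ≈⟨ ∙-congˡ K≈R ⟩
        z ∙ longest R      ≈⟨ w≈ ⟨
        w                  ∎) w′∈

      w≈longest : w ≈ longest I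
      w≈longest = LeftMax⇒longest I w∈I left

      I⊆R : set I ⊆ set R
      I⊆R i∈ = fromWitness (RightMax-cong (≈-sym w≈longest) (longest-RightMax I) i∈)

      expression-I : ReducedExpression I I (z ∙ longest I)
      expression-I = ReducedExpression-cong {I} {I} (≈-sym (≈-trans (∙-congʳ z≈ε) (identityˡ _))) (record
        { expression    = [ (λ i∈ → i∈) , (λ i∈ → i∈) ]
        ; expresses     = ≈-refl
        ; turns-reduced = identityˡ _ , ≡.refl })

    expression-R : ReducedExpression I R (z ∙ longest R)
    expression-R with em {P = ℓ y < ℓ w}
    ... | yes ℓy<ℓw = ascend-to {I} {R} {z} short K K⊆R (rec ℓy<ℓw y-LeftMax
            (RightShortest⇒RightMax K {z} (RightShortest-⊆ {z = z} K⊆R short)))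
    ... | no  ℓy≮ℓw = ascend-to {I} {R} {z} short I (I⊆R ℓw≤ℓy) (expression-I ℓw≤ℓy)
      where
      ℓw≤ℓy : ℓ w ≤ ℓ y
      ℓw≤ℓy = ℕ.≮⇒≥ ℓy≮ℓw

  reduced-expression : ∀ {I J w} → LeftMax (set I) w → RightMax (set J) w → ReducedExpression I J w
  reduced-expression {I} {J} {w} left right = go {J} {w} left right (<-wellFounded (ℓ w))
    where
    go : ∀ {J w} → LeftMax (set I) w → RightMax (set J) w → Acc _<_ (ℓ w) → ReducedExpression I J w
    go {J} {w} left right (acc rec) =
      let z , short , w≈ = RightMax-decomposition (rightDescents w) {w} toWitness in
      descend-to {I} {J} (rightDescents w) (λ j∈ → fromWitness (right j∈))
        (ReducedExpression-cong {I} {rightDescents w} (≈-sym w≈)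
          (Peel.expression-R I {w} left {z} short w≈
            λ {K} {y} ℓy<ℓw left′ right′ → go {K} {y} left′ right′ (rec ℓy<ℓw)))

  reduced-expression-exists : ∀ {I J} (q : Coset I J) →
    ∃ λ (E : Expression I J) → Expresses E q × Reduced E q
  reduced-expression-exists {I} {J} q = expression R , ≈-sym (expresses R) ,
    ≈-sym (≈-trans (product-∷ʳ qs P) (proj₁ (turns-reduced R))) ,
    ≡.sym (≡.trans (total-∷ʳ qs P) (proj₂ (turns-reduced R)))
    where
    R = reduced-expression {I} {J} {max q} (max-LeftMax q) (max-RightMax q)
    T = multistep (expression R)
    qs = map quotient (Turns.pairs T)
    P = longest (Turns.peak T)

theorem2p16 : (em : ∀ {a} → ExcludedMiddle a) →
    ∀ {c e s : Level} (C : CoxeterSystem c e s) →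
    let open Coxeter em C in
    (I J : Finitary) (p q : Coset I J) →
    (max p ≤ᴮ max q ⇔ min p ≤ᴮ min q)
    × (min p ≤ᴮ min q ⇔ (Σ[ E ∈ Expression I J ] Expresses E q × Reduced E q × Path E p))
    × ((Σ[ E ∈ Expression I J ] Expresses E q × Reduced E q × Path E p)
    ⇔ (∀ (E : Expression I J) → Expresses E q → Path E p))
theorem2p16 em C I J p q =
    mk⇔ (max≤⇒min≤ p q) (min≤⇒max≤ p q)
  , mk⇔ (λ min≤ → some (min≤⇒max≤ p q min≤)) (λ witness → max≤⇒min≤ p q (bound witness))
  , mk⇔ (λ witness → every (bound witness))
        (λ all → let E , expresses , reduced = reduced-expression-exists q in
                 E , expresses , reduced , all E expresses)
  where
  open Coxeter em C
  open CoxeterTheory em C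

  every : max p ≤ᴮ max q → ∀ E → Expresses E q → Path E p
  every max≤ E expresses = Equivalence.from (path⇔max≤ E p q expresses) max≤

  some : max p ≤ᴮ max q → Σ[ E ∈ Expression I J ] Expresses E q × Reduced E q × Path E p
  some max≤ = let E , expresses , reduced = reduced-expression-exists q in
    E , expresses , reduced , every max≤ E expresses

  bound : Σ[ E ∈ Expression I J ] Expresses E q × Reduced E q × Path E p → max p ≤ᴮ max q
  bound (E , expresses , _ , path) = Equivalence.to (path⇔max≤ E p q expresses) path
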